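{- Let $n\ge 5$ be an integer. (1) For $2\leq \ell \leq n-1$, $e_{n-2}(n,\ell,n-1)=n-1$. (2) For $2\leq \ell \leq n-1$, $$e_{n-2}(n,\ell,n-2)=\begin{cases} n, & \text{if } 2\leq \ell \leq n-2,\\ n-1, & \text{if } \ell=n-1.\end{cases}$$ (3) The following hold for $i\in\{0,1\}$: - $e_{n-2}(n,n-1-i,n-3)=2n-2$ whenever $n\geq 5+i$; - $e_{n-2}(n,n-3-i,n-3)=2n-3$ whenever $n\geq 7+2i$; - $e_{n-2}(n,n-5-i,n-3)=2n-4$ whenever $n\geq 11+2i$; - $e_{n-2}(n,n-7-i,n-3)=2n-5$ whenever $n\geq 15+2i$. Moreover, for $6\leq \ell \leq n-9$, let $s$ be the unique integer with $2\le s\le 5$ such that $n=4r+\ell+s+3$ for some integer $r\ge 1$. Then $$\tfrac{1}{2}(3n+\ell-3)\leq e_{n-2}(n,\ell,n-3)\leq \tfrac{1}{2}(3n+\ell+s-5),$$ and if $s=2$, then $e_{n-2}(n,\ell,n-3)=\frac{1}{2}(3n+\ell-3)$.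
   Context: All graphs are finite, simple and undirected; $e(G)$ is the number of edges of $G$ and $\Delta(G)$ its maximum degree. For a graph $G$ and a nonempty set $S\subseteq V(G)$, the Steiner distance $d_G(S)$ is the minimum number of edges of a connected subgraph of $G$ whose vertex set contains $S$, with $d_G(S)=\infty$ if there is no such subgraph. For $2\le k\le n=|V(G)|$, the Steiner $k$-diameter is $sdiam_k(G)=\max\{d_G(S) : S\subseteq V(G),\ |S|=k\}$ (so it is $\infty$ if some $k$-set lies in no connected subgraph). For natural numbers $n,\ell,d$ with $\ell<n$ and $d<n$, $\mathscr{H}_k(n,\ell,d)$ is the set of all graphs $G$ of order $n$ with maximum degree exactly $\ell$ and $sdiam_k(G)\le d$, and $e_k(n,\ell,d)=\min\{e(G): G\in\mathscr{H}_k(n,\ell,d)\}$, with $e_k(n,\ell,d)=\infty$ if $\mathscr{H}_k(n,\ell,d)$ is empty. The parameter $k$ is assumed to satisfy $3\le k\le n$. -}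

module Defs where

open import Data.Bool.Base using (true; false)
open import Data.Fin.Base using (Fin; _<_)
open import Data.Fin.Properties using (all?; _≟_; _<?_)
open import Data.Fin.Subset using (Subset; _∈_; _⊆_; ∣_∣)
open import Data.Fin.Subset.Properties using (_∈?_; _⊆?_)
open import Data.List.Base
  using (List; []; _∷_; map; filter; length; allFin; cartesianProduct; cartesianProductWith)
import Data.List.Extrema
import Data.List.Extrema.Nat as ℕ-Extrema
open import Data.List.Membership.Propositional using () renaming (_∈_ to _∈ᴸ_)
open import Data.List.Membership.Propositional.Properties
  using (∈-cartesianProductWith⁺; ∈-allFin)
open import Data.List.Relation.Unary.Any using (here; there)
open import Data.Nat.Base using (ℕ; zero; suc; _≤_)
import Data.Nat.Properties as ℕ
open import Data.Product.Base using (_×_; _,_; proj₁; proj₂)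
open import Data.Sum.Base using (_⊎_; inj₁; inj₂)
open import Data.Vec.Base using (Vec; []; _∷_; lookup)
open import Function.Base using (_∘_)
open import Level using (0ℓ)
open import Relation.Binary.Bundles using (TotalOrder)
open import Relation.Binary.Construct.Add.Supremum.NonStrict (_≤_)
  using (_≤⁺_; ≤⁺-dec; ≤⁺-isTotalOrder-≡)
open import Relation.Binary.Construct.Closure.ReflexiveTransitive using (Star; ε; _◅_; _◅◅_)
import Relation.Binary.Definitions as B
open import Relation.Binary.PropositionalEquality.Core using (_≡_; refl)
open import Relation.Nullary.Construct.Add.Supremum using (_⁺; ⊤⁺; [_])
open import Relation.Nullary.Decidable
  using (Dec; yes; no; map′; recompute; _×-dec_; _⊎-dec_; _→-dec_; ¬?)
open import Relation.Nullary.Negation using (¬_; contradiction)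
open import Relation.Unary using (Decidable)

-- ⊤⁺ plays the role of ∞; it is the default value of every minimum below, so
-- that a minimum over no candidates is ∞.
ℕ∞ : Set
ℕ∞ = ℕ ⁺

ℕ∞-totalOrder : TotalOrder 0ℓ 0ℓ 0ℓ
ℕ∞-totalOrder = record { isTotalOrder = ≤⁺-isTotalOrder-≡ ℕ.≤-isTotalOrder }

module ℕ∞-Extrema = Data.List.Extrema ℕ∞-totalOrder

IsSymmetric IsLoopless IsSimple : ∀ {n} → Vec (Subset n) n → Set
IsSymmetric A = ∀ u v → v ∈ lookup A u → u ∈ lookup A v
IsLoopless  A = ∀ u → ¬ (u ∈ lookup A u)
IsSimple    A = IsSymmetric A × IsLoopless A

-- A simple undirected graph on the vertex set Fin n, given by its table of
-- open neighbourhoods.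
-- The axioms are irrelevant so that graphs with equal tables are equal.
record Graph (n : ℕ) : Set where
  constructor mkGraph
  field
    nbhd    : Vec (Subset n) n
    .simple : IsSimple nbhd

open Graph public using (nbhd)

Adj : ∀ {n} → Graph n → Fin n → Fin n → Set
Adj G u v = v ∈ lookup (nbhd G) u

adj? : ∀ {n} (G : Graph n) → B.Decidable (Adj G)
adj? G u v = v ∈? lookup (nbhd G) u

isSimple? : ∀ {n} → Decidable (IsSimple {n})
isSimple? A =
  (all? λ u → all? λ v → (v ∈? lookup A u) →-dec (u ∈? lookup A v))
  ×-dec (all? λ u → ¬? (u ∈? lookup A u))

Adj-simple : ∀ {n} (G : Graph n) → IsSimple (nbhd G)
Adj-simple (mkGraph A s) = recompute (isSimple? A) s

-- Each edge is listed once, as the pair (u , v) with u < v.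
edges : ∀ {n} → Graph n → List (Fin n × Fin n)
edges {n} G = filter (λ (u , v) → (u <? v) ×-dec adj? G u v)
                     (cartesianProduct (allFin n) (allFin n))

e : ∀ {n} → Graph n → ℕ
e G = length (edges G)

degree : ∀ {n} → Graph n → Fin n → ℕ
degree G v = ∣ lookup (nbhd G) v ∣

Δ : ∀ {n} → Graph n → ℕ
Δ {n} G = ℕ-Extrema.max 0 (map (degree G) (allFin n))

-- (W , F) stands for the graph with vertex set W and the edges of F; it is
-- only meaningful when W contains all ends of edges of F, which is part of
-- being a subgraph.
IsSubgraph : ∀ {n} → Graph n → Subset n × Graph n → Set
IsSubgraph G (W , F) = ∀ u v → Adj F u v → Adj G u v × u ∈ W × v ∈ W

IsConnected : ∀ {n} → Subset n × Graph n → Set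
IsConnected (W , F) = ∀ u v → u ∈ W → v ∈ W → Star (Adj F) u v

Connects : ∀ {n} → Graph n → Subset n → Subset n × Graph n → Set
Connects G S H = IsSubgraph G H × IsConnected H × S ⊆ proj₁ H

-- Reachability in a finite relation is decidable (Warshall's algorithm):
-- Via xs u v holds if there is a path from u to v with interior in xs.
module _ {A : Set} {R : A → A → Set} where

  Via : List A → A → A → Set
  Via []       u v = u ≡ v ⊎ R u v
  Via (x ∷ xs) u v = Via xs u v ⊎ (Via xs u x × Via xs x v)

  via? : B.DecidableEquality A → B.Decidable R → ∀ xs → B.Decidable (Via xs)
  via? _≟ᴬ_ R? []       u v = (u ≟ᴬ v) ⊎-dec R? u v
  via? _≟ᴬ_ R? (x ∷ xs) u v =
    via? _≟ᴬ_ R? xs u v ⊎-dec (via? _≟ᴬ_ R? xs u x ×-dec via? _≟ᴬ_ R? xs x v)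

  via⇒star : ∀ xs {u v} → Via xs u v → Star R u v
  via⇒star []       (inj₁ refl)    = ε
  via⇒star []       (inj₂ r)       = r ◅ ε
  via⇒star (x ∷ xs) (inj₁ p)       = via⇒star xs p
  via⇒star (x ∷ xs) (inj₂ (p , q)) = via⇒star xs p ◅◅ via⇒star xs q

  base⇒via : ∀ xs {u v} → u ≡ v ⊎ R u v → Via xs u v
  base⇒via []       p = p
  base⇒via (x ∷ xs) p = inj₁ (base⇒via xs p)

  to-head : ∀ x xs {u} → Via (x ∷ xs) u x → Via xs u x
  to-head x xs (inj₁ p)       = p
  to-head x xs (inj₂ (p , _)) = p

  from-head : ∀ x xs {v} → Via (x ∷ xs) x v → Via xs x v
  from-head x xs (inj₁ p)       = p
  from-head x xs (inj₂ (_ , p)) = p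

  via-trans : ∀ xs {u w v} → w ∈ᴸ xs → Via xs u w → Via xs w v → Via xs u v
  via-trans (x ∷ xs) (here refl) p q = inj₂ (to-head x xs p , from-head x xs q)
  via-trans (x ∷ xs) (there w∈) (inj₁ p) (inj₁ q) = inj₁ (via-trans xs w∈ p q)
  via-trans (x ∷ xs) (there w∈) (inj₁ p) (inj₂ (q , r)) =
    inj₂ (via-trans xs w∈ p q , r)
  via-trans (x ∷ xs) (there w∈) (inj₂ (o , p)) (inj₁ q) =
    inj₂ (o , via-trans xs w∈ p q)
  via-trans (x ∷ xs) (there w∈) (inj₂ (o , _)) (inj₂ (_ , r)) = inj₂ (o , r)

  star⇒via : ∀ xs → (∀ x → x ∈ᴸ xs) → ∀ {u v} → Star R u v → Via xs u v
  star⇒via xs all ε        = base⇒via xs (inj₁ refl)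
  star⇒via xs all (r ◅ rs) =
    via-trans xs (all _) (base⇒via xs (inj₂ r)) (star⇒via xs all rs)

  star? : B.DecidableEquality A → B.Decidable R →
          ∀ xs → (∀ x → x ∈ᴸ xs) → B.Decidable (Star R)
  star? _≟ᴬ_ R? xs all u v =
    map′ (via⇒star xs) (star⇒via xs all) (via? _≟ᴬ_ R? xs u v)

connects? : ∀ {n} (G : Graph n) (S : Subset n) → Decidable (Connects G S)
connects? {n} G S (W , F) =
  (all? λ u → all? λ v →
     adj? F u v →-dec (adj? G u v ×-dec (u ∈? W) ×-dec (v ∈? W)))
  ×-dec
  (all? λ u → all? λ v →
     (u ∈? W) →-dec ((v ∈? W) →-dec
       star? _≟_ (adj? F) (allFin n) ∈-allFin u v))
  ×-dec (S ⊆? W)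

vecs : ∀ {A : Set} → List A → ∀ n → List (Vec A n)
vecs xs zero    = [] ∷ []
vecs xs (suc n) = cartesianProductWith _∷_ xs (vecs xs n)

subsets : ∀ n → List (Subset n)
subsets n = vecs (false ∷ true ∷ []) n

simpleTables : ∀ {n} → List (Vec (Subset n) n) → List (Graph n)
simpleTables []       = []
simpleTables (A ∷ As) with isSimple? A
... | yes s = mkGraph A s ∷ simpleTables As
... | no  _ = simpleTables As

graphs : ∀ n → List (Graph n)
graphs n = simpleTables (vecs (subsets n) n)

∈-vecs : ∀ {A : Set} {xs : List A} → (∀ x → x ∈ᴸ xs) →
         ∀ {n} (v : Vec A n) → v ∈ᴸ vecs xs n
∈-vecs all []      = here refl
∈-vecs all (x ∷ v) = ∈-cartesianProductWith⁺ _∷_ (all x) (∈-vecs all v)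

∈-subsets : ∀ {n} (S : Subset n) → S ∈ᴸ subsets n
∈-subsets = ∈-vecs λ { false → here refl ; true → there (here refl) }

∈-simpleTables : ∀ {n} {As : List (Vec (Subset n) n)} (G : Graph n) →
                 nbhd G ∈ᴸ As → G ∈ᴸ simpleTables As
∈-simpleTables {As = A ∷ _} G A∈ with isSimple? A | A∈
... | yes _ | here refl = here refl
... | yes _ | there A∈′ = there (∈-simpleTables G A∈′)
... | no ¬s | here refl = contradiction (Adj-simple G) ¬s
... | no _  | there A∈′ = ∈-simpleTables G A∈′

∈-graphs : ∀ {n} (G : Graph n) → G ∈ᴸ graphs n
∈-graphs G = ∈-simpleTables G (∈-vecs ∈-subsets (nbhd G))

steinerDistance : ∀ {n} → Graph n → Subset n → ℕ∞
steinerDistance {n} G S = ℕ∞-Extrema.min ⊤⁺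
  (map ([_] ∘ e ∘ proj₂)
       (filter (connects? G S) (cartesianProduct (subsets n) (graphs n))))

-- For k ≤ n there is a k-subset of Fin n, so the default value 0 plays no
-- role in the maximum.
sdiam : ∀ {n} → ℕ → Graph n → ℕ∞
sdiam {n} k G = ℕ∞-Extrema.max [ 0 ]
  (map (steinerDistance G) (filter (λ S → ∣ S ∣ ℕ.≟ k) (subsets n)))

ℋ : (k n ℓ d : ℕ) → Graph n → Set
ℋ k n ℓ d G = Δ G ≡ ℓ × sdiam k G ≤⁺ [ d ]

ℋ? : ∀ k n ℓ d → Decidable (ℋ k n ℓ d)
ℋ? k n ℓ d G = (Δ G ℕ.≟ ℓ) ×-dec ≤⁺-dec ℕ._≤?_ (sdiam k G) [ d ]

eMin : (k n ℓ d : ℕ) → ℕ∞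
eMin k n ℓ d = ℕ∞-Extrema.min ⊤⁺ (map ([_] ∘ e) (filter (ℋ? k n ℓ d) (graphs n)))

module Submission where

-- A connected subgraph on a vertex set W has at least ∣ W ∣ ∸ 1 edges, so for
-- k = n ∸ 2 the bound on the Steiner diameter only constrains connectivity:
-- d = n ∸ 1 means that G is connected, d = n ∸ 2 that G has at most one cut
-- vertex, and d = n ∸ 3 that G stays connected after deleting any two vertices.
-- The first minimum is attained by brooms.  In the second case a vertex of
-- degree ℓ ≤ n ∸ 2 has a neighbour of degree at least 2, and deleting these two
-- vertices shows that there are at least n edges; a cycle with pendant edges at
-- one vertex attains this.  In the third case all degrees are at least 3, so
-- 2 e(G) ≥ 3 (n ∸ 1) + ℓ, and for ℓ ≥ 4 this is attained up to parity: take a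
-- wheel, remove the spokes of two arcs of p rim vertices each, and join the
-- arcs by p rungs.

open import Defs
open import Data.Bool.Base using (true; false)
open import Data.Empty using (⊥; ⊥-elim)
open import Data.Fin.Base as Fin using (Fin; zero; suc; toℕ)
import Data.Fin.Properties as Fin
open import Data.Fin.Subset using (Subset; _∈_; _∉_; _⊆_; ∣_∣; ⁅_⁆; _∪_) renaming (⊤ to full)
open import Data.Fin.Subset.Properties
  using (_∈?_; ∈⊤; ∣⊤∣≡n; x∈⁅x⁆; x∈⁅y⁆⇒x≡y; ∣⁅x⁆∣≡1;
         p⊆q⇒∣p∣≤∣q∣; p⊂q⇒∣p∣<∣q∣; ⊆-antisym; ∣p∣≡n⇒p≡⊤; ∣p∣≤n; x∈p∪q⁺; x∈p∪q⁻)
open import Data.List.Base as List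
  using (List; []; _∷_; _++_; map; length; allFin; filter; cartesianProduct; applyUpTo; replicate)
import Data.List.Extrema.Nat as ℕ-Extrema
open import Data.List.Membership.DecPropositional using () renaming (_∈?_ to member?)
open import Data.List.Membership.Propositional using (lose) renaming (_∈_ to _∈ᴸ_; _∉_ to _∉ᴸ_)
open import Data.List.Membership.Propositional.Properties
  using (∈-∃++; ∈-++⁺ˡ; ∈-++⁺ʳ; ∈-++⁻; ∈-map⁺; ∈-map⁻; ∈-filter⁺; ∈-filter⁻; ∈-cartesianProduct⁺;
         ∈-allFin; ∈-applyUpTo⁺; ∈-applyUpTo⁻)
open import Data.List.Properties
  using (map-++; length-++; length-map; length-tabulate; length-applyUpTo; length-replicate)
open import Data.List.Relation.Binary.Disjoint.Propositional using (Disjoint)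
open import Data.List.Relation.Binary.Subset.Propositional renaming (_⊆_ to _⊆ᴸ_)
open import Data.List.Relation.Binary.Permutation.Propositional using (_↭_; ↭-refl; ↭-trans; prep)
open import Data.List.Relation.Binary.Permutation.Propositional.Properties
  using (shift; ∈-resp-↭; ↭-length; map⁺)
open import Data.List.Relation.Unary.All as All using (All; []; _∷_)
import Data.List.Relation.Unary.All.Properties as All
open import Data.List.Relation.Unary.AllPairs using ([]; _∷_)
open import Data.List.Relation.Unary.Any as Any using (Any; here; there)
open import Data.List.Relation.Unary.Unique.Propositional using (Unique)
open import Data.List.Relation.Unary.Unique.Propositional.Properties as Unique
  using (Unique[x∷xs]⇒x∉xs)
open import Data.Nat.Base
open import Data.Nat.DivMod using (m%n<n; m≡m%n+[m/n]*n; [m+kn]%n≡m%n; m<n⇒m%n≡m)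
open import Data.Nat.ListAction using (sum)
open import Data.Nat.ListAction.Properties using (sum-++; sum-↭)
open import Data.Nat.Properties
open import Data.Nat.Tactic.RingSolver using (solve-∀)
open import Data.Product using (_×_; _,_; proj₁; proj₂; ∃; ∃-syntax; ∃₂; ∃!; swap; uncurry)
open import Data.Product.Properties using (≡-dec; ,-injectiveʳ; ,-injectiveˡ)
open import Data.Sum.Base as Sum using (_⊎_; inj₁; inj₂; [_,_]′)
open import Data.Vec.Base as Vec using ([]; _∷_; lookup; tabulate)
open import Data.Vec.Properties using (lookup∘tabulate; []=⇒lookup; lookup⇒[]=)
open import Function.Base using (_∘_; id)
open import Level using (0ℓ)
open import Relation.Binary.Construct.Add.Supremum.NonStrict _≤_
  using (_≤⁺_; [_]; _≤⊤⁺; ≤⁺-antisym-≡; ≤⁺-trans)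
open import Relation.Binary.Construct.Closure.ReflexiveTransitive as Star using (Star; ε; _◅_; _◅◅_)
open import Relation.Binary.Definitions using (tri<; tri≈; tri>)
open import Relation.Binary.PropositionalEquality
open import Relation.Nullary.Construct.Add.Supremum using ([_]; ⊤⁺)
open import Relation.Nullary.Decidable using (Dec; yes; no; does; ¬?; _×-dec_; _⊎-dec_; dec-true)
open import Relation.Nullary.Negation using (¬_; contradiction)
open import Relation.Unary using (Pred; Decidable)

-- Finite sets

-- Connectivity of the third family after two deletions is not tested cut by cut. Every rim vertex
-- without a spoke gets three paths to the hub with disjoint interiors, and two deleted vertices
-- cannot meet all three; if the hub itself is deleted, what is left of the rim is a path. This
-- shapes the ladder: a rail must lead to a spoke in both directions, and each rung must lead to a
-- third spoke. For the lower rail this takes two distinct spokes beyond the upper arc, which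
-- together with the two spokes between the arcs explains ℓ ≥ 4. The count is equally rigid. Of the
-- n ∸ 1 rim vertices, ℓ have a spoke and 2p + δ have none; rungs serve 2p of these in pairs, and an
-- odd one out borrows an edge to a vertex that already has degree 3. Twice the size is thus 3(n ∸
-- 1) + ℓ + δ with δ ≤ 1, the least integer that the degree bound permits. So the minimum is known
-- exactly for every ℓ ≥ 4, and both the four closed formulas and the interval in terms of s are
-- read off from this one value.

Unique-⊆⇒↭ : ∀ {A : Set} {xs ys : List A} → Unique xs → xs ⊆ᴸ ys → ∃[ zs ] ys ↭ xs ++ zs
Unique-⊆⇒↭ {xs = []}         _          _   = _ , ↭-refl
Unique-⊆⇒↭ {xs = x ∷ xs} {ys} (x∉ ∷ xs!) sub with ∈-∃++ (sub (here refl))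
... | as , bs , refl = let zs , p = Unique-⊆⇒↭ xs! sub′ in
  zs , ↭-trans (shift x as bs) (prep x p)
  where
  sub′ : xs ⊆ᴸ as ++ bs
  sub′ y∈ with ∈-resp-↭ (shift x as bs) (sub (there y∈))
  ... | here refl = contradiction y∈ (Unique[x∷xs]⇒x∉xs (x∉ ∷ xs!))
  ... | there y∈′ = y∈′

Unique-⊆⇒length≤ : ∀ {A : Set} {xs ys : List A} → Unique xs → xs ⊆ᴸ ys → length xs ≤ length ys
Unique-⊆⇒length≤ {xs = xs} {ys} xs! sub with Unique-⊆⇒↭ xs! sub
... | zs , p = subst (length xs ≤_) (sym (trans (↭-length p) (length-++ xs))) (m≤m+n _ _)

elements : ∀ {n} → Subset n → List (Fin n)
elements []          = []
elements (true ∷ p)  = zero ∷ map suc (elements p)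
elements (false ∷ p) = map suc (elements p)

length-elements : ∀ {n} (p : Subset n) → length (elements p) ≡ ∣ p ∣
length-elements []          = refl
length-elements (true ∷ p)  = cong suc (trans (length-map Fin.suc (elements p)) (length-elements p))
length-elements (false ∷ p) = trans (length-map Fin.suc (elements p)) (length-elements p)

∈-elements⁺ : ∀ {n} {p : Subset n} {x} → x ∈ p → x ∈ᴸ elements p
∈-elements⁺ {p = true ∷ p} Vec.here           = here refl
∈-elements⁺ {p = true ∷ p} (Vec.there x∈p)    = there (∈-map⁺ suc (∈-elements⁺ x∈p))
∈-elements⁺ {p = false ∷ p} (Vec.there x∈p)   = ∈-map⁺ suc (∈-elements⁺ x∈p)

∈-elements⁻ : ∀ {n} {p : Subset n} {x} → x ∈ᴸ elements p → x ∈ p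
∈-elements⁻ {p = true ∷ p} (here refl) = Vec.here
∈-elements⁻ {p = true ∷ p} (there x∈) with ∈-map⁻ suc x∈
... | _ , y∈ , refl = Vec.there (∈-elements⁻ y∈)
∈-elements⁻ {p = false ∷ p} x∈ with ∈-map⁻ suc x∈
... | _ , y∈ , refl = Vec.there (∈-elements⁻ y∈)

elements! : ∀ {n} (p : Subset n) → Unique (elements p)
elements! []          = []
elements! (true ∷ p)  =
  All.map⁺ (All.tabulate λ _ ()) ∷ Unique.map⁺ Fin.suc-injective (elements! p)
elements! (false ∷ p) = Unique.map⁺ Fin.suc-injective (elements! p)

∣p∣≤length : ∀ {n} {p : Subset n} {xs} → (∀ {x} → x ∈ p → x ∈ᴸ xs) → ∣ p ∣ ≤ length xs
∣p∣≤length {p = p} {xs} p⊆xs = subst (_≤ length xs) (length-elements p)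
  (Unique-⊆⇒length≤ (elements! p) (p⊆xs ∘ ∈-elements⁻))

length≤∣p∣ : ∀ {n} {p : Subset n} {xs} → Unique xs → (∀ {x} → x ∈ᴸ xs → x ∈ p) → length xs ≤ ∣ p ∣
length≤∣p∣ {p = p} {xs} xs! xs⊆p = subst (length xs ≤_) (length-elements p)
  (Unique-⊆⇒length≤ xs! (∈-elements⁺ ∘ xs⊆p))

opaque
  ∉-fresh : ∀ {n} (xs : List (Fin n)) → length xs < n → ∃[ x ] x ∉ᴸ xs
  ∉-fresh {n} xs ∣xs∣<n with Fin.all? (λ x → member? Fin._≟_ x xs)
  ... | yes all = contradiction
    (≤-<-trans (subst (_≤ length xs) (length-tabulate id)
      (Unique-⊆⇒length≤ (Unique.allFin⁺ n) λ {x} _ → all x)) ∣xs∣<n) (n≮n n)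
  ... | no ¬all = Fin.¬∀⟶∃¬ n _ (λ x → member? Fin._≟_ x xs) ¬all

⟦_⟧ : ∀ {n} {P : Pred (Fin n) 0ℓ} → Decidable P → Subset n
⟦ P? ⟧ = tabulate (does ∘ P?)

module _ {n} {P : Pred (Fin n) 0ℓ} (P? : Decidable P) where

  ∈⟦⟧⁺ : ∀ {x} → P x → x ∈ ⟦ P? ⟧
  ∈⟦⟧⁺ {x} px = lookup⇒[]= x _ (trans (lookup∘tabulate _ x) (dec-true (P? x) px))

  ∈⟦⟧⁻ : ∀ {x} → x ∈ ⟦ P? ⟧ → P x
  ∈⟦⟧⁻ {x} x∈ with P? x | trans (sym (lookup∘tabulate (does ∘ P?) x)) ([]=⇒lookup x∈)
  ... | yes px | _  = px
  ... | no  _  | ()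

allBut : ∀ {n} → List (Fin n) → Subset n
allBut xs = ⟦ (λ x → ¬? (member? Fin._≟_ x xs)) ⟧

module _ {n} (xs : List (Fin n)) where

  ∈-allBut⁺ : ∀ {x} → x ∉ᴸ xs → x ∈ allBut xs
  ∈-allBut⁺ = ∈⟦⟧⁺ (λ x → ¬? (member? Fin._≟_ x xs))

  ∈-allBut⁻ : ∀ {x} → x ∈ allBut xs → x ∉ᴸ xs
  ∈-allBut⁻ = ∈⟦⟧⁻ (λ x → ¬? (member? Fin._≟_ x xs))

  ∣allBut∣+length : Unique xs → ∣ allBut xs ∣ + length xs ≡ n
  ∣allBut∣+length xs! = trans
    (cong (_+ length xs) (sym (length-elements (allBut xs))))
    (trans (sym (length-++ els)) (≤-antisym ≤n n≤))
    where
    els = elements (allBut xs)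
    ≤n : length (els ++ xs) ≤ n
    ≤n = subst (length (els ++ xs) ≤_) (length-tabulate id)
      (Unique-⊆⇒length≤
        (Unique.++⁺ (elements! (allBut xs)) xs! (λ (x∈els , x∈xs) → ∈-allBut⁻ (∈-elements⁻ {p = allBut xs} x∈els) x∈xs))
        (λ {x} _ → ∈-allFin x))
    n≤ : n ≤ length (els ++ xs)
    n≤ = subst (_≤ length (els ++ xs)) (length-tabulate id)
      (Unique-⊆⇒length≤ (Unique.allFin⁺ n) (λ {x} _ → in-one x))
      where
      in-one : ∀ x → x ∈ᴸ els ++ xs
      in-one x with member? Fin._≟_ x xs
      ... | yes x∈xs = ∈-++⁺ʳ els x∈xs
      ... | no  x∉xs = ∈-++⁺ˡ (∈-elements⁺ (∈-allBut⁺ x∉xs))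

pair! : ∀ {A : Set} {x y : A} → x ≢ y → Unique (x ∷ y ∷ [])
pair! x≢y = (x≢y ∷ []) ∷ [] ∷ []

∉pair : ∀ {A : Set} {v x y : A} → v ≢ x → v ≢ y → v ∉ᴸ x ∷ y ∷ []
∉pair v≢x v≢y (here v≡x)         = v≢x v≡x
∉pair v≢x v≢y (there (here v≡y)) = v≢y v≡y

-- Graphs

module _ {n} {G : Graph n} where

  Adj-sym : ∀ {u v} → Adj G u v → Adj G v u
  Adj-sym = proj₁ (Adj-simple G) _ _

  Adj⇒≢ : ∀ {u v} → Adj G u v → u ≢ v
  Adj⇒≢ uv refl = proj₂ (Adj-simple G) _ uv

module _ {n} {R : Fin n → Fin n → Set} (R? : ∀ u v → Dec (R u v))
         (R-sym : ∀ {u v} → R u v → R v u) (R-irrefl : ∀ {u} → ¬ R u u) where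

  private
    table : Vec.Vec (Subset n) n
    table = tabulate λ u → ⟦ R? u ⟧

    row : ∀ u → lookup table u ≡ ⟦ R? u ⟧
    row = lookup∘tabulate _

    ∈-row⁺ : ∀ {u v} → R u v → v ∈ lookup table u
    ∈-row⁺ {u} r = subst (_ ∈_) (sym (row u)) (∈⟦⟧⁺ (R? u) r)

    ∈-row⁻ : ∀ {u v} → v ∈ lookup table u → R u v
    ∈-row⁻ {u} v∈ = ∈⟦⟧⁻ (R? u) (subst (_ ∈_) (row u) v∈)

  opaque
    fromRelation : Graph n
    fromRelation = mkGraph table
      ((λ u v v∈ → ∈-row⁺ (R-sym (∈-row⁻ v∈))) , (λ u u∈ → R-irrefl (∈-row⁻ u∈)))

    Adj-fromRelation⁺ : ∀ {u v} → R u v → Adj fromRelation u v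
    Adj-fromRelation⁺ = ∈-row⁺

    Adj-fromRelation⁻ : ∀ {u v} → Adj fromRelation u v → R u v
    Adj-fromRelation⁻ = ∈-row⁻

module _ {n} (G : Graph n) where

  ∈-edges⁺ : ∀ {u v} → u Fin.< v → Adj G u v → (u , v) ∈ᴸ edges G
  ∈-edges⁺ u<v uv = ∈-filter⁺ (λ (u , v) → (u Fin.<? v) ×-dec adj? G u v)
    (∈-cartesianProduct⁺ (∈-allFin _) (∈-allFin _)) (u<v , uv)

  ∈-edges⁻ : ∀ {u v} → (u , v) ∈ᴸ edges G → u Fin.< v × Adj G u v
  ∈-edges⁻ uv∈ = proj₂ (∈-filter⁻ (λ (u , v) → (u Fin.<? v) ×-dec adj? G u v)
    {xs = cartesianProduct (allFin n) (allFin n)} uv∈)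

  edges! : Unique (edges G)
  edges! = Unique.filter⁺ (λ (u , v) → (u Fin.<? v) ×-dec adj? G u v)
    (Unique.cartesianProduct⁺ (Unique.allFin⁺ n) (Unique.allFin⁺ n))

e-mono : ∀ {n} {F G : Graph n} → (∀ {u v} → Adj F u v → Adj G u v) → e F ≤ e G
e-mono {F = F} {G} F⊆G = Unique-⊆⇒length≤ (edges! F) λ uv∈ →
  let u<v , uv = ∈-edges⁻ F uv∈ in ∈-edges⁺ G u<v (F⊆G uv)

toℕ² : ∀ {n} → Fin n × Fin n → ℕ × ℕ
toℕ² (u , v) = toℕ u , toℕ v

toℕ²-injective : ∀ {n} {x y : Fin n × Fin n} → toℕ² x ≡ toℕ² y → x ≡ y
toℕ²-injective eq = cong₂ _,_ (Fin.toℕ-injective (,-injectiveˡ eq)) (Fin.toℕ-injective (,-injectiveʳ eq))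

sort : ℕ × ℕ → ℕ × ℕ
sort (a , b) = a ⊓ b , a ⊔ b

-- `edges` puts the smaller end first while `L` may use either order, so the comparison takes place
-- after sorting each pair of `L`. Repetitions in `L` only weaken the bound.
e≤length : ∀ {n} {G : Graph n} L →
           (∀ {u v} → Adj G u v → toℕ² (u , v) ∈ᴸ L ⊎ toℕ² (v , u) ∈ᴸ L) → e G ≤ length L
e≤length {G = G} L cover = subst₂ _≤_ (length-map toℕ² (edges G)) (length-map sort L)
  (Unique-⊆⇒length≤ (Unique.map⁺ toℕ²-injective (edges! G)) in-map)
  where
  sorted : ∀ {u v} → u Fin.< v × Adj G u v → toℕ² (u , v) ∈ᴸ map sort L
  sorted (u<v , uv) with cover uv
  ... | inj₁ uv∈ = subst (_∈ᴸ map sort L)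
    (cong₂ _,_ (m≤n⇒m⊓n≡m (<⇒≤ u<v)) (m≤n⇒m⊔n≡n (<⇒≤ u<v))) (∈-map⁺ sort uv∈)
  ... | inj₂ vu∈ = subst (_∈ᴸ map sort L)
    (cong₂ _,_ (m≥n⇒m⊓n≡n (<⇒≤ u<v)) (m≥n⇒m⊔n≡m (<⇒≤ u<v))) (∈-map⁺ sort vu∈)
  in-map : map toℕ² (edges G) ⊆ᴸ map sort L
  in-map x∈ with ∈-map⁻ toℕ² x∈
  ... | _ , uv∈ , refl = sorted (∈-edges⁻ G uv∈)

e-strict : ∀ {n} {F G : Graph n} → (∀ {u v} → Adj F u v → Adj G u v) →
           ∀ {a b} → a ≢ b → Adj G a b → ¬ Adj F a b → suc (e F) ≤ e G
e-strict {n} {F} {G} F⊆G {a} {b} a≢b ab ¬ab with Fin.<-cmp a b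
... | tri< a<b _ _ = Unique-⊆⇒length≤ {xs = (a , b) ∷ edges F}
  (All.tabulate (λ { uv∈ refl → ¬ab (proj₂ (∈-edges⁻ F uv∈)) }) ∷ edges! F)
  λ { (here refl) → ∈-edges⁺ G a<b ab
    ; (there uv∈) → let u<v , uv = ∈-edges⁻ F uv∈ in ∈-edges⁺ G u<v (F⊆G uv) }
... | tri≈ _ a≡b _ = contradiction a≡b a≢b
... | tri> _ _ b<a = Unique-⊆⇒length≤ {xs = (b , a) ∷ edges F}
  (All.tabulate (λ { uv∈ refl → ¬ab (Adj-sym {G = F} (proj₂ (∈-edges⁻ F uv∈))) }) ∷ edges! F)
  λ { (here refl) → ∈-edges⁺ G b<a (Adj-sym {G = G} ab)
    ; (there uv∈) → let u<v , uv = ∈-edges⁻ F uv∈ in ∈-edges⁺ G u<v (F⊆G uv) }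

empty : ∀ n → Graph n
empty n = fromRelation {n} {λ _ _ → ⊥} (λ _ _ → no λ ()) (λ ()) (λ ())

Adj-empty : ∀ {n} {u v : Fin n} → ¬ Adj (empty n) u v
Adj-empty {n} = Adj-fromRelation⁻ {n} {λ _ _ → ⊥} (λ _ _ → no λ ()) (λ ()) (λ ())

e-empty : ∀ n → e (empty n) ≡ 0
e-empty n = n≤0⇒n≡0 (e≤length {G = empty n} [] (⊥-elim ∘ Adj-empty))

module _ {n} (G : Graph n) {a b : Fin n} (a≢b : a ≢ b) where

  private
    R : Fin n → Fin n → Set
    R u v = Adj G u v ⊎ (u ≡ a × v ≡ b) ⊎ (u ≡ b × v ≡ a)

    R? : ∀ u v → Dec (R u v)
    R? u v = adj? G u v ⊎-dec ((u Fin.≟ a) ×-dec (v Fin.≟ b)) ⊎-dec ((u Fin.≟ b) ×-dec (v Fin.≟ a))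

    R-sym : ∀ {u v} → R u v → R v u
    R-sym (inj₁ uv)               = inj₁ (Adj-sym {G = G} uv)
    R-sym (inj₂ (inj₁ (u≡a , v≡b))) = inj₂ (inj₂ (v≡b , u≡a))
    R-sym (inj₂ (inj₂ (u≡b , v≡a))) = inj₂ (inj₁ (v≡a , u≡b))

    R-irrefl : ∀ {u} → ¬ R u u
    R-irrefl (inj₁ uu)                   = Adj⇒≢ {G = G} uu refl
    R-irrefl (inj₂ (inj₁ (refl , refl))) = a≢b refl
    R-irrefl (inj₂ (inj₂ (refl , refl))) = a≢b refl

  opaque
    addEdge : Graph n
    addEdge = fromRelation R? R-sym R-irrefl

    addEdge-new : Adj addEdge a b
    addEdge-new = Adj-fromRelation⁺ R? R-sym R-irrefl (inj₂ (inj₁ (refl , refl)))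

    addEdge-old : ∀ {u v} → Adj G u v → Adj addEdge u v
    addEdge-old = Adj-fromRelation⁺ R? R-sym R-irrefl ∘ inj₁

    addEdge⁻ : ∀ {u v} → Adj addEdge u v → Adj G u v ⊎ (u ≡ a × v ≡ b) ⊎ (u ≡ b × v ≡ a)
    addEdge⁻ = Adj-fromRelation⁻ R? R-sym R-irrefl

  addEdge-⊆ : ∀ {H : Graph n} → (∀ {u v} → Adj G u v → Adj H u v) → Adj H a b →
              ∀ {u v} → Adj addEdge u v → Adj H u v
  addEdge-⊆ {H} G⊆H ab uv with addEdge⁻ uv
  ... | inj₁ uv′                  = G⊆H uv′
  ... | inj₂ (inj₁ (refl , refl)) = ab
  ... | inj₂ (inj₂ (refl , refl)) = Adj-sym {G = H} ab

  e-addEdge : ¬ Adj G a b → e addEdge ≡ suc (e G)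
  e-addEdge ¬ab = ≤-antisym
    (subst (e addEdge ≤_) (length-map toℕ² L) (e≤length {G = addEdge} (map toℕ² L) cover))
    (e-strict {F = G} {addEdge} addEdge-old a≢b addEdge-new ¬ab)
    where
    L : List (Fin n × Fin n)
    L = (a , b) ∷ edges G
    cover : ∀ {u v} → Adj addEdge u v → toℕ² (u , v) ∈ᴸ map toℕ² L ⊎ toℕ² (v , u) ∈ᴸ map toℕ² L
    cover {u} {v} uv with addEdge⁻ uv | Fin.<-cmp u v
    ... | inj₂ (inj₁ (refl , refl)) | _ = inj₁ (here refl)
    ... | inj₂ (inj₂ (refl , refl)) | _ = inj₂ (here refl)
    ... | inj₁ uv′ | tri< u<v _ _ = inj₁ (there (∈-map⁺ toℕ² (∈-edges⁺ G u<v uv′)))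
    ... | inj₁ uv′ | tri≈ _ u≡v _ = contradiction u≡v (Adj⇒≢ {G = G} uv′)
    ... | inj₁ uv′ | tri> _ _ v<u = inj₂ (there (∈-map⁺ toℕ² (∈-edges⁺ G v<u (Adj-sym {G = G} uv′))))

-- Connected vertex sets

Inside : ∀ {n} → Graph n → Subset n → Fin n → Fin n → Set
Inside G W u v = Adj G u v × u ∈ W × v ∈ W

-- Connectedness of the subgraph induced on `W`. Steiner distance asks for a vertex set and an edge
-- set; with induced subgraphs only the vertex set has to be chosen, and `spanning-tree` supplies
-- the edges.
Conn : ∀ {n} → Graph n → Subset n → Set
Conn G W = ∀ {u v} → u ∈ W → v ∈ W → Star (Inside G W) u v

conn-from : ∀ {n} {G : Graph n} {W} c → (∀ {u} → u ∈ W → Star (Inside G W) u c) → Conn G W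
conn-from {G = G} c to-c u∈ v∈ = to-c u∈ ◅◅ Star.reverse flip-edge (to-c v∈)
  where
  flip-edge : ∀ {a b} → Inside G _ a b → Inside G _ b a
  flip-edge (ab , a∈ , b∈) = Adj-sym {G = G} ab , b∈ , a∈

opaque
  crossing : ∀ {A : Set} {R : A → A → Set} {P : A → Set} → (∀ x → Dec (P x)) →
             ∀ {u v} → Star R u v → P u → ¬ P v → ∃₂ λ a b → R a b × P a × ¬ P b
  crossing P? ε         pu ¬pv = contradiction pu ¬pv
  crossing P? (_◅_ {j = w} r rs) pu ¬pv with P? w
  ... | yes pw = crossing P? rs pw ¬pv
  ... | no ¬pw = _ , _ , r , pu , ¬pw

first-step : ∀ {A : Set} {R : A → A → Set} {u v} → u ≢ v → Star R u v → ∃ (R u)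
first-step u≢v ε       = contradiction refl u≢v
first-step u≢v (r ◅ _) = _ , r

-- Being a tree is expressed by connectedness and the number of edges, the two facts that enter
-- Steiner distances.
record SpanningTree {n} (G : Graph n) (W : Subset n) : Set where
  field
    tree      : Graph n
    subgraph  : IsSubgraph G (W , tree)
    connected : IsConnected (W , tree)
    size      : suc (e tree) ≡ ∣ W ∣

∣p∪⁅x⁆∣ : ∀ {n} {p : Subset n} {x} → x ∉ p → ∣ p ∪ ⁅ x ⁆ ∣ ≡ suc ∣ p ∣
∣p∪⁅x⁆∣ {p = p} {x} x∉p = ≤-antisym
  (subst (∣ p ∪ ⁅ x ⁆ ∣ ≤_) (cong suc (length-elements p)) (∣p∣≤length {xs = x ∷ elements p} cover))
  (subst (_≤ ∣ p ∪ ⁅ x ⁆ ∣) (cong suc (length-elements p))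
    (length≤∣p∣ (All.tabulate (λ { y∈ refl → x∉p (∈-elements⁻ y∈) }) ∷ elements! p) packed))
  where
  cover : ∀ {y} → y ∈ p ∪ ⁅ x ⁆ → y ∈ᴸ x ∷ elements p
  cover y∈ with x∈p∪q⁻ p ⁅ x ⁆ y∈
  ... | inj₁ y∈p = there (∈-elements⁺ y∈p)
  ... | inj₂ y∈x = here (x∈⁅y⁆⇒x≡y x y∈x)
  packed : ∀ {y} → y ∈ᴸ x ∷ elements p → y ∈ p ∪ ⁅ x ⁆
  packed (here refl) = x∈p∪q⁺ (inj₂ (x∈⁅x⁆ x))
  packed (there y∈)  = x∈p∪q⁺ (inj₁ (∈-elements⁻ y∈))

opaque
  -- The walk inside `W` from the root to `x` leaves `U` along some edge `ab`. Attaching `b` as a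
  -- leaf adds one vertex and one edge, which preserves the relation in `size`.
  grow : ∀ {n} {G : Graph n} {U W : Subset n} → Conn G W → (T : SpanningTree G U) →
         U ⊆ W → ∃ (_∈ U) → ∀ {x} → x ∈ W → x ∉ U →
         ∃[ y ] (y ∈ W × y ∉ U × SpanningTree G (U ∪ ⁅ y ⁆))
  grow {n} {G} {U} conn T U⊆W (r , r∈U) x∈W x∉U
    with crossing (_∈? U) (conn (U⊆W r∈U) x∈W) r∈U x∉U
  ... | a , b , (ab , _ , b∈W) , a∈U , b∉U = b , b∈W , b∉U , record
    { tree      = T′
    ; subgraph  = sub
    ; connected = λ u v u∈ v∈ → to-a u∈ ◅◅ Star.reverse (Adj-sym {G = T′}) (to-a v∈)
    ; size      = trans (cong suc (e-addEdge tree a≢b ¬ab)) (trans (cong suc size) (sym (∣p∪⁅x⁆∣ b∉U)))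
    }
    where
    open SpanningTree T
    a≢b : a ≢ b
    a≢b refl = b∉U a∈U
    ¬ab : ¬ Adj tree a b
    ¬ab ab′ = b∉U (proj₂ (proj₂ (subgraph a b ab′)))
    T′ : Graph n
    T′ = addEdge tree a≢b
    old : ∀ {u} → u ∈ U → u ∈ U ∪ ⁅ b ⁆
    old u∈ = x∈p∪q⁺ (inj₁ u∈)
    new : b ∈ U ∪ ⁅ b ⁆
    new = x∈p∪q⁺ (inj₂ (x∈⁅x⁆ b))
    sub : IsSubgraph G (U ∪ ⁅ b ⁆ , T′)
    sub u v uv with addEdge⁻ tree a≢b uv
    ... | inj₂ (inj₁ (refl , refl)) = ab , old a∈U , new
    ... | inj₂ (inj₂ (refl , refl)) = Adj-sym {G = G} ab , new , old a∈U
    ... | inj₁ uv′ = let uv″ , u∈ , v∈ = subgraph u v uv′ in uv″ , old u∈ , old v∈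
    to-a : ∀ {u} → u ∈ U ∪ ⁅ b ⁆ → Star (Adj T′) u a
    to-a u∈ with x∈p∪q⁻ U ⁅ b ⁆ u∈
    ... | inj₁ u∈U = Star.map (addEdge-old tree a≢b) (connected _ a u∈U a∈U)
    ... | inj₂ u∈b with x∈⁅y⁆⇒x≡y b u∈b
    ...   | refl = Adj-sym {G = T′} (addEdge-new tree a≢b) ◅ ε

  point-tree : ∀ {n} (G : Graph n) c → SpanningTree G ⁅ c ⁆
  point-tree {n} G c = record
    { tree      = empty n
    ; subgraph  = λ _ _ uv → contradiction uv Adj-empty
    ; connected = λ u v u∈ v∈ → subst (Star _ u) (trans (x∈⁅y⁆⇒x≡y c u∈) (sym (x∈⁅y⁆⇒x≡y c v∈))) ε
    ; size      = trans (cong suc (e-empty n)) (sym (∣⁅x⁆∣≡1 c))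
    }

  spanning-tree : ∀ {n} {G : Graph n} {W : Subset n} {c} → Conn G W → c ∈ W → SpanningTree G W
  spanning-tree {n} {G} {W} {c} conn c∈W =
    go n (point-tree G c) point⊆W (c , x∈⁅x⁆ c) (m≤m+n n _)
    where
    point⊆W : ⁅ c ⁆ ⊆ W
    point⊆W x∈ = subst (_∈ W) (sym (x∈⁅y⁆⇒x≡y c x∈)) c∈W
    -- The fuel is at least the number of vertices outside `U`; once it is spent, `U` is the whole
    -- vertex set.
    go : ∀ fuel {U} → SpanningTree G U → U ⊆ W → ∃ (_∈ U) → n ≤ fuel + ∣ U ∣ → SpanningTree G W
    go fuel {U} T U⊆W r n≤ with Fin.any? (λ x → (x ∈? W) ×-dec ¬? (x ∈? U))
    ... | no none = subst (SpanningTree G) (⊆-antisym U⊆W W⊆U) T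
      where
      W⊆U : W ⊆ U
      W⊆U {x} x∈W with x ∈? U
      ... | yes x∈U = x∈U
      ... | no  x∉U = contradiction (x , x∈W , x∉U) none
    go zero {U} T U⊆W r n≤ | yes (x , x∈W , x∉U) =
      contradiction (subst (x ∈_) (sym (∣p∣≡n⇒p≡⊤ (≤-antisym (∣p∣≤n U) n≤))) ∈⊤) x∉U
    go (suc fuel) {U} T U⊆W r n≤ | yes (x , x∈W , x∉U) with grow conn T U⊆W r x∈W x∉U
    ... | y , y∈W , y∉U , T′ = go fuel T′ U′⊆W (proj₁ r , x∈p∪q⁺ (inj₁ (proj₂ r)))
      (subst (n ≤_) (trans (sym (+-suc fuel ∣ U ∣)) (cong (fuel +_) (sym (∣p∪⁅x⁆∣ y∉U)))) n≤)
      where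
      U′⊆W : U ∪ ⁅ y ⁆ ⊆ W
      U′⊆W x∈ with x∈p∪q⁻ U ⁅ y ⁆ x∈
      ... | inj₁ x∈U = U⊆W x∈U
      ... | inj₂ x∈y = subst (_∈ W) (sym (x∈⁅y⁆⇒x≡y y x∈y)) y∈W

tree⊆ : ∀ {n} {G : Graph n} {W : Subset n} (T : SpanningTree G W) →
        ∀ {u v} → Adj (SpanningTree.tree T) u v → Adj G u v
tree⊆ T uv = proj₁ (SpanningTree.subgraph T _ _ uv)

conn⇒∣W∣≤ : ∀ {n} {G : Graph n} {W : Subset n} {c} → Conn G W → c ∈ W → ∣ W ∣ ≤ suc (e G)
conn⇒∣W∣≤ {G = G} conn c∈W = subst (_≤ suc (e G)) size (s≤s (e-mono {F = tree} {G} (tree⊆ {G = G} T)))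
  where
  T = spanning-tree conn c∈W
  open SpanningTree T

-- Connectedness is moved from `G` to the connecting subgraph `F` itself, so that `conn⇒∣W∣≤` bounds
-- `∣ W ∣` by the edges of `F`, which the Steiner distance controls.
connected-subgraph : ∀ {n} {G F : Graph n} {W : Subset n} →
                     IsSubgraph G (W , F) → IsConnected (W , F) → Conn F W
connected-subgraph sub conn u∈ v∈ =
  Star.map (λ ab → ab , proj₂ (sub _ _ ab)) (conn _ _ u∈ v∈)

-- Steiner diameter

steiner≤⁺ : ∀ {n d} {G F : Graph n} {S W} → Connects G S (W , F) → e F ≤ d →
            steinerDistance G S ≤⁺ [ d ]
steiner≤⁺ {n} {d} {G} {F} {S} {W} c eF≤d = ℕ∞-Extrema.min≤v⁺ ⊤⁺ _ (inj₂ (lose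
  (∈-map⁺ ([_] ∘ e ∘ proj₂)
    (∈-filter⁺ (connects? G S) {xs = cartesianProduct (subsets n) (graphs n)}
      (∈-cartesianProduct⁺ (∈-subsets W) (∈-graphs F)) c))
  [ eF≤d ]))

opaque
  steiner≤⁻ : ∀ {n d} {G : Graph n} {S} → steinerDistance G S ≤⁺ [ d ] →
              ∃₂ λ W F → Connects G S (W , F) × e F ≤ d
  steiner≤⁻ {n} {d} {G} {S} dist≤ with ℕ∞-Extrema.argmin-sel id ⊤⁺
    (map ([_] ∘ e ∘ proj₂) (filter (connects? G S) (cartesianProduct (subsets n) (graphs n))))
  -- The default `⊤⁺` is not below `[ d ]`, so a candidate attains the minimum.
  ... | inj₁ ≡⊤ = contradiction (subst (_≤⁺ [ d ]) ≡⊤ dist≤) λ ()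
  ... | inj₂ ∈cands with ∈-map⁻ ([_] ∘ e ∘ proj₂) ∈cands
  ...   | (W , F) , WF∈ , ≡eF with subst (_≤⁺ [ d ]) ≡eF dist≤
  ...     | [ eF≤d ] = W , F ,
    proj₂ (∈-filter⁻ (connects? G S) {xs = cartesianProduct (subsets n) (graphs n)} WF∈) , eF≤d

-- A spanning tree of `W` has `∣ W ∣ ∸ 1` edges, so an upper bound on the diameter reduces to
-- deleting enough vertices outside `S` without losing connectedness.
sdiam≤⁺ : ∀ {n k d} {G : Graph n} →
          (∀ S → ∣ S ∣ ≡ k → ∃[ W ] (S ⊆ W × Conn G W × ∃ (_∈ W) × ∣ W ∣ ≤ suc d)) →
          sdiam k G ≤⁺ [ d ]
sdiam≤⁺ {n} {k} {d} {G} cover = ℕ∞-Extrema.max≤v⁺ [ z≤n ] (All.map⁺ (All.tabulate dist≤))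
  where
  dist≤ : ∀ {S} → S ∈ᴸ filter (λ S → ∣ S ∣ ≟ k) (subsets n) → steinerDistance G S ≤⁺ [ d ]
  dist≤ {S} S∈ with cover S (proj₂ (∈-filter⁻ (λ S → ∣ S ∣ ≟ k) {xs = subsets n} S∈))
  ... | W , S⊆W , conn , (c , c∈W) , ∣W∣≤ =
    steiner≤⁺ {G = G} {tree} (subgraph , connected , S⊆W) (s≤s⁻¹ (subst (_≤ suc d) (sym size) ∣W∣≤))
    where
    open SpanningTree (spanning-tree {G = G} conn c∈W)

opaque
  sdiam≤⁻ : ∀ {n k d} {G : Graph n} → sdiam k G ≤⁺ [ d ] → ∀ S → ∣ S ∣ ≡ k →
            ∃₂ λ W F → Connects G S (W , F) × e F ≤ d
  sdiam≤⁻ {n} {k} {d} {G} diam≤ S ∣S∣ = steiner≤⁻ {G = G}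
    (≤⁺-trans ≤-trans
      (All.lookup (All.map⁻ (ℕ∞-Extrema.xs≤max [ 0 ] _))
        (∈-filter⁺ (λ S → ∣ S ∣ ≟ k) (∈-subsets S) ∣S∣))
      diam≤)

-- Degrees and the minimum size

module _ {n} {G : Graph n} where

  ≤degree : ∀ {v xs} → Unique xs → (∀ {u} → u ∈ᴸ xs → Adj G v u) → length xs ≤ degree G v
  ≤degree = length≤∣p∣

Δ≡⁺ : ∀ {n ℓ} {G : Graph n} v → degree G v ≡ ℓ → (∀ u → degree G u ≤ ℓ) → Δ G ≡ ℓ
Δ≡⁺ {G = G} v refl deg≤ = ℕ-Extrema.max≈v⁺ {xs = map (degree G) (allFin _)}
  (∈-map⁺ (degree G) (∈-allFin v)) (All.map⁺ (All.tabulate λ {u} _ → deg≤ u)) z≤n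

Δ≡⁻ : ∀ {n ℓ} {G : Graph n} → 1 ≤ ℓ → Δ G ≡ ℓ → ∃[ v ] degree G v ≡ ℓ
Δ≡⁻ {n} {ℓ} {G} 1≤ℓ Δ≡ with ℕ-Extrema.argmax-sel id 0 (map (degree G) (allFin n))
-- The default 0 of the maximum is excluded by `1 ≤ ℓ`.
... | inj₁ ≡0 = contradiction (trans (sym ≡0) Δ≡) (<⇒≢ 1≤ℓ)
... | inj₂ ∈degs with ∈-map⁻ (degree G) ∈degs
...   | v , _ , ≡deg = v , trans (sym ≡deg) Δ≡

-- The lower bound on all of `ℋ` applies to the witness as well, so for `G` an upper bound on its
-- size is enough. Hence the edge lists of the constructions are counted with possible repetitions.
eMin≡ : ∀ {n k ℓ d m} (G : Graph n) → ℋ k n ℓ d G → e G ≤ m →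
        (∀ (H : Graph n) → ℋ k n ℓ d H → m ≤ e H) → eMin k n ℓ d ≡ [ m ]
eMin≡ {n} {k} {ℓ} {d} {m} G G∈ℋ eG≤m m≤ = ≤⁺-antisym-≡ ≤-antisym
  (ℕ∞-Extrema.min≤v⁺ ⊤⁺ _ (inj₂ (lose
    (∈-map⁺ ([_] ∘ e) (∈-filter⁺ (ℋ? k n ℓ d) (∈-graphs G) G∈ℋ)) [ eG≤m ])))
  (ℕ∞-Extrema.v≤min⁺ (_ ≤⊤⁺) (All.map⁺ (All.tabulate λ {H} H∈ →
    [ m≤ H (proj₂ (∈-filter⁻ (ℋ? k n ℓ d) {xs = graphs n} H∈)) ])))

-- Degree sums

module _ {n} (G : Graph n) where

  -- Darts are oriented edges. Grouped by their tails they number the sum of the degrees, and each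
  -- edge has only two orientations; comparing the counts gives `handshake`.
  darts : List (Fin n) → List (Fin n × Fin n)
  darts []       = []
  darts (u ∷ us) = map (u ,_) (elements (lookup (nbhd G) u)) ++ darts us

  ∈-darts : ∀ us {u v} → (u , v) ∈ᴸ darts us → u ∈ᴸ us × Adj G u v
  ∈-darts (w ∷ us) uv∈ with ∈-++⁻ (map (w ,_) (elements (lookup (nbhd G) w))) uv∈
  ... | inj₂ uv∈us = let u∈us , uv = ∈-darts us uv∈us in there u∈us , uv
  ... | inj₁ uv∈w with ∈-map⁻ (w ,_) uv∈w
  ...   | _ , v∈ , refl = here refl , ∈-elements⁻ {p = lookup (nbhd G) w} v∈

  darts! : ∀ {us} → Unique us → Unique (darts us)
  darts! [] = []
  darts! {u ∷ us} (u∉ ∷ us!) =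
    Unique.++⁺ (Unique.map⁺ ,-injectiveʳ (elements! (lookup (nbhd G) u))) (darts! us!) disjoint
    where
    disjoint : Disjoint (map (u ,_) (elements (lookup (nbhd G) u))) (darts us)
    disjoint (x∈ , x∈′) with ∈-map⁻ (u ,_) x∈
    ... | _ , _ , refl = Unique[x∷xs]⇒x∉xs (u∉ ∷ us!) (proj₁ (∈-darts us x∈′))

  length-darts : ∀ us → length (darts us) ≡ sum (map (degree G) us)
  length-darts []       = refl
  length-darts (u ∷ us) = trans (length-++ (map (u ,_) (elements (lookup (nbhd G) u))))
    (cong₂ _+_ (trans (length-map (u ,_) (elements (lookup (nbhd G) u))) (length-elements (lookup (nbhd G) u))) (length-darts us))

  handshake : sum (map (degree G) (allFin n)) ≤ e G + e G
  handshake = begin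
    sum (map (degree G) (allFin n))        ≡⟨ length-darts (allFin n) ⟨
    length (darts (allFin n))              ≤⟨ Unique-⊆⇒length≤ (darts! (Unique.allFin⁺ n)) in-edges ⟩
    length (edges G ++ map swap (edges G)) ≡⟨ length-++ (edges G) ⟩
    e G + length (map swap (edges G))      ≡⟨ cong (e G +_) (length-map swap (edges G)) ⟩
    e G + e G                              ∎
    where
    open ≤-Reasoning
    in-edges : darts (allFin n) ⊆ᴸ edges G ++ map swap (edges G)
    in-edges {u , v} uv∈ with ∈-darts (allFin n) uv∈ | Fin.<-cmp u v
    ... | _ , uv | tri< u<v _ _ = ∈-++⁺ˡ (∈-edges⁺ G u<v uv)
    ... | _ , uv | tri≈ _ u≡v _ = contradiction u≡v (Adj⇒≢ {G = G} uv)
    ... | _ , uv | tri> _ _ v<u =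
      ∈-++⁺ʳ (edges G) (∈-map⁺ swap (∈-edges⁺ G v<u (Adj-sym {G = G} uv)))

sum≥ : ∀ {A : Set} {f : A → ℕ} {c} → (∀ x → c ≤ f x) → ∀ xs → length xs * c ≤ sum (map f xs)
sum≥ c≤f []       = z≤n
sum≥ c≤f (x ∷ xs) = +-mono-≤ (c≤f x) (sum≥ c≤f xs)

-- Every entry of `ys` left over by `xs` contributes at least `c`. Moving `length xs * c` to the
-- right avoids truncated subtraction.
sum-⊆ : ∀ {A : Set} {f : A → ℕ} {c} → (∀ x → c ≤ f x) → ∀ {xs ys} → Unique xs → xs ⊆ᴸ ys →
        sum (map f xs) + length ys * c ≤ sum (map f ys) + length xs * c
sum-⊆ {f = f} {c} c≤f {xs} {ys} xs! sub with Unique-⊆⇒↭ xs! sub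
... | zs , p = begin
  sum (map f xs) + length ys * c                    ≡⟨ cong (λ l → Σxs + l * c) len ⟩
  sum (map f xs) + (length xs + length zs) * c      ≡⟨ rearrange Σxs (length xs) (length zs) c ⟩
  sum (map f xs) + length zs * c + length xs * c    ≤⟨ +-monoˡ-≤ _ (+-monoʳ-≤ Σxs (sum≥ c≤f zs)) ⟩
  sum (map f xs) + sum (map f zs) + length xs * c   ≡⟨ cong (_+ length xs * c) Σys ⟨
  sum (map f ys) + length xs * c                    ∎
  where
  open ≤-Reasoning
  Σxs = sum (map f xs)
  len : length ys ≡ length xs + length zs
  len = trans (↭-length p) (length-++ xs)
  Σys : sum (map f ys) ≡ sum (map f xs) + sum (map f zs)
  Σys = trans (sum-↭ (map⁺ f p)) (trans (cong sum (map-++ f xs zs)) (sum-++ (map f xs) (map f zs)))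
  rearrange : ∀ s a b c → s + (a + b) * c ≡ s + b * c + a * c
  rearrange = solve-∀

-- Lower bounds

∣allBut-pair∣ : ∀ {n} {x y : Fin n} → x ≢ y → ∣ allBut (x ∷ y ∷ []) ∣ ≡ n ∸ 2
∣allBut-pair∣ {n} {x} {y} x≢y = trans (sym (m+n∸n≡m _ 2)) (cong (_∸ 2) (∣allBut∣+length _ (pair! x≢y)))

module _ {n d} {G : Graph n} (diam≤ : sdiam (n ∸ 2) G ≤⁺ [ d ]) where

  -- Any finite bound will do: with at least four vertices, two vertices other than `u` and `v` can
  -- be omitted, and a Steiner tree of the remaining set joins `u` to `v`.
  sdiam⇒conn : 4 ≤ n → Conn G full
  sdiam⇒conn 4≤n {u} {v} _ _ =
    let x , x∉ = ∉-fresh (u ∷ v ∷ []) (≤-trans (n≤1+n 3) 4≤n)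
        y , y∉ = ∉-fresh (u ∷ v ∷ x ∷ []) 4≤n
        W , F , (sub , conn , S⊆W) , _ = sdiam≤⁻ {G = G} diam≤ (allBut (x ∷ y ∷ []))
          (∣allBut-pair∣ λ x≡y → y∉ (there (there (here (sym x≡y)))))
    in Star.map (λ ab → proj₁ (sub _ _ ab) , ∈⊤ , ∈⊤)
      (conn u v (S⊆W (in-S (x∉ ∘ here ∘ sym) (y∉ ∘ here ∘ sym)))
                (S⊆W (in-S (x∉ ∘ there ∘ here ∘ sym) (y∉ ∘ there ∘ here ∘ sym))))
    where
    in-S : ∀ {w x y} → w ≢ x → w ≢ y → w ∈ allBut (x ∷ y ∷ [])
    in-S w≢x w≢y = ∈-allBut⁺ _ (∉pair w≢x w≢y)

  n≤1+e : 4 ≤ n → n ≤ suc (e G)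
  n≤1+e 4≤n = subst (_≤ suc (e G)) (∣⊤∣≡n n)
    (conn⇒∣W∣≤ {G = G} (sdiam⇒conn 4≤n) (∈⊤ {x = proj₁ (∉-fresh [] (≤-trans (s≤s z≤n) 4≤n))}))

Adj-⊆ : ∀ {n} → Graph n → Graph n → Set
Adj-⊆ F G = ∀ {u v} → Adj F u v → Adj G u v

-- A vertex outside W is not covered by F, so all its edges are new.
e-extend : ∀ {n} {G F : Graph n} {W : Subset n} → IsSubgraph G (W , F) →
           ∀ {x a b} → x ∉ W → Adj G x a → Adj G x b → a ≢ b →
           ∃[ F′ ] (e F′ ≡ 2 + e F × Adj-⊆ F′ G ×
             (∀ {w c} → Adj F′ w c → Adj F w c ⊎ (w ≡ x ⊎ c ≡ x)))
e-extend {n} {G} {F} {W} sub {x} {a} {b} x∉W xa xb a≢b = F₂ , size , F₂⊆G , new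
  where
  x≢a = Adj⇒≢ {G = G} xa
  x≢b = Adj⇒≢ {G = G} xb
  F₁ = addEdge F x≢a
  F₂ = addEdge F₁ x≢b
  ¬F-x : ∀ {c} → ¬ Adj F x c
  ¬F-x xc = x∉W (proj₁ (proj₂ (sub _ _ xc)))
  ¬F₁-xb : ¬ Adj F₁ x b
  ¬F₁-xb xb′ with addEdge⁻ F x≢a xb′
  ... | inj₁ xb″             = ¬F-x xb″
  ... | inj₂ (inj₁ (_ , b≡a)) = a≢b (sym b≡a)
  ... | inj₂ (inj₂ (x≡a , _)) = x≢a x≡a
  size : e F₂ ≡ 2 + e F
  size = trans (e-addEdge F₁ x≢b ¬F₁-xb) (cong suc (e-addEdge F x≢a ¬F-x))
  F₂⊆G : Adj-⊆ F₂ G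
  F₂⊆G = addEdge-⊆ F₁ x≢b {H = G}
    (addEdge-⊆ F x≢a {H = G} (λ uv → proj₁ (sub _ _ uv)) xa) xb
  new : ∀ {w c} → Adj F₂ w c → Adj F w c ⊎ (w ≡ x ⊎ c ≡ x)
  new wc with addEdge⁻ F₁ x≢b wc
  ... | inj₂ (inj₁ (w≡x , _)) = inj₂ (inj₁ w≡x)
  ... | inj₂ (inj₂ (_ , c≡x)) = inj₂ (inj₂ c≡x)
  ... | inj₁ wc′ with addEdge⁻ F x≢a wc′
  ...   | inj₁ wc″ = inj₁ wc″
  ...   | inj₂ (inj₁ (w≡x , _)) = inj₂ (inj₁ w≡x)
  ...   | inj₂ (inj₂ (_ , c≡x)) = inj₂ (inj₂ c≡x)

HasTwo : ∀ {n} → Graph n → Fin n → Set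
HasTwo G x = ∃₂ λ a b → Adj G x a × Adj G x b × a ≢ b

neighbour≢ : ∀ {n} {G : Graph n} {x} → HasTwo G x → ∀ y → ∃[ c ] (Adj G x c × c ≢ y)
neighbour≢ (a , b , xa , xb , a≢b) y with a Fin.≟ y
... | no  a≢y  = a , xa , a≢y
... | yes refl = b , xb , a≢b ∘ sym

degree≥2⇒HasTwo : ∀ {n} {G : Graph n} {x} → 2 ≤ degree G x → HasTwo G x
degree≥2⇒HasTwo {G = G} {x} 2≤deg
  with elements (lookup (nbhd G) x) | elements! (lookup (nbhd G) x)
     | ∈-elements⁻ {p = lookup (nbhd G) x} | length-elements (lookup (nbhd G) x)
... | []        | _                | _  | len = contradiction (subst (2 ≤_) (sym len) 2≤deg) λ ()
... | _ ∷ []    | _                | _  | len = contradiction (subst (2 ≤_) (sym len) 2≤deg) λ { (s≤s ()) }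
... | a ∷ b ∷ _ | (a≢b ∷ _) ∷ _ | ∈⁻ | _   = a , b , ∈⁻ (here refl) , ∈⁻ (there (here refl)) , a≢b

-- At least one of x and w is missing from the Steiner tree of all other
-- vertices, since that tree has at most n ∸ 1 vertices.
two-branching⇒n≤e : ∀ {n} {G : Graph n} → 4 ≤ n → sdiam (n ∸ 2) G ≤⁺ [ n ∸ 2 ] →
                    ∀ {x w} → x ≢ w → HasTwo G x → HasTwo G w → n ≤ e G
two-branching⇒n≤e {n} {G} 4≤n diam≤ {x} {w} x≢w two-x two-w
  = by-cases (x ∈? W) (w ∈? W)
  where
  open ≤-Reasoning
  steiner : ∃₂ λ W F → Connects G (allBut (x ∷ w ∷ [])) (W , F) × e F ≤ n ∸ 2
  steiner = sdiam≤⁻ {G = G} diam≤ (allBut (x ∷ w ∷ [])) (∣allBut-pair∣ x≢w)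
  W : Subset n
  W = proj₁ steiner
  F : Graph n
  F = proj₁ (proj₂ steiner)
  sub : IsSubgraph G (W , F)
  sub = proj₁ (proj₁ (proj₂ (proj₂ steiner)))
  conn : IsConnected (W , F)
  conn = proj₁ (proj₂ (proj₁ (proj₂ (proj₂ steiner))))
  S⊆W : allBut (x ∷ w ∷ []) ⊆ W
  S⊆W = proj₂ (proj₂ (proj₁ (proj₂ (proj₂ steiner))))
  eF≤ : e F ≤ n ∸ 2
  eF≤ = proj₂ (proj₂ (proj₂ steiner))
  2≤n : 2 ≤ n
  2≤n = ≤-trans (s≤s (s≤s z≤n)) 4≤n
  others : ∀ {v} → v ≢ x → v ≢ w → v ∈ W
  others v≢x v≢w = S⊆W (∈-allBut⁺ _ (∉pair v≢x v≢w))
  ∃∈W : ∃ (_∈ W)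
  ∃∈W with c , c∉ ← ∉-fresh (x ∷ w ∷ []) (≤-trans (n≤1+n 3) 4≤n) =
    c , others (c∉ ∘ here) (c∉ ∘ there ∘ here)
  ∣W∣≤ : ∣ W ∣ ≤ suc (e F)
  ∣W∣≤ = conn⇒∣W∣≤ {G = F} (connected-subgraph {G = G} {F} sub conn) (proj₂ ∃∈W)
  -- `F` joins the `n ∸ 1` vertices other than `y`, so it has at least `n ∸ 2` edges, and two
  -- further edges of `G` meet `y`.
  one-missing : ∀ {y} → (∀ {v} → v ≢ y → v ∈ W) → HasTwo G y → y ∉ W → n ≤ e G
  one-missing {y} rest (a , b , ya , yb , a≢b) y∉W =
    let F′ , size , F′⊆G , _ = e-extend {G = G} {F} sub y∉W ya yb a≢b in begin
    n                       ≡⟨ trans (sym (∣allBut∣+length (y ∷ []) ([] ∷ []))) (+-comm _ 1) ⟩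
    suc ∣ allBut (y ∷ []) ∣ ≤⟨ s≤s (p⊆q⇒∣p∣≤∣q∣ λ v∈ → rest (∈-allBut⁻ (y ∷ []) v∈ ∘ here)) ⟩
    suc ∣ W ∣               ≤⟨ s≤s ∣W∣≤ ⟩
    2 + e F                 ≡⟨ size ⟨
    e F′                    ≤⟨ e-mono {F = F′} {G} F′⊆G ⟩
    e G                     ∎
  by-cases : Dec (x ∈ W) → Dec (w ∈ W) → n ≤ e G
  by-cases (yes x∈W) (yes w∈W) = contradiction
    (begin-strict
      n                ≡⟨ ∣⊤∣≡n n ⟨
      ∣ full {n} ∣     ≤⟨ p⊆q⇒∣p∣≤∣q∣ {p = full} (λ {v} _ → all v) ⟩
      ∣ W ∣            ≤⟨ ∣W∣≤ ⟩
      suc (e F)        ≤⟨ s≤s eF≤ ⟩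
      suc (n ∸ 2)      <⟨ n<1+n _ ⟩
      2 + (n ∸ 2)      ≡⟨ m+[n∸m]≡n 2≤n ⟩
      n                ∎)
    (n≮n n)
    where
    all : ∀ v → v ∈ W
    all v with v Fin.≟ x | v Fin.≟ w
    ... | yes refl | _        = x∈W
    ... | no _     | yes refl = w∈W
    ... | no v≢x   | no v≢w   = others v≢x v≢w
  by-cases (yes x∈W) (no w∉W) = one-missing rest two-w w∉W
    where
    rest : ∀ {v} → v ≢ w → v ∈ W
    rest {v} v≢w with v Fin.≟ x
    ... | yes refl = x∈W
    ... | no v≢x   = others v≢x v≢w
  by-cases (no x∉W) (yes w∈W) = one-missing rest two-x x∉W
    where
    rest : ∀ {v} → v ≢ x → v ∈ W
    rest {v} v≢x with v Fin.≟ w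
    ... | yes refl = w∈W
    ... | no v≢w   = others v≢x v≢w
  by-cases (no x∉W) (no w∉W) = both-missing two-x (neighbour≢ {G = G} two-w x)
    where
    both-missing : HasTwo G x → ∃[ c ] (Adj G w c × c ≢ x) → n ≤ e G
    both-missing (a , b , xa , xb , a≢b) (c , wc , c≢x) =
      -- `F` has at least `n ∸ 3` edges. Two edges at `x` and one at `w` are new; `c ≢ x` keeps the
      -- third from being one of the first two in case `x` and `w` are adjacent.
      let F′ , size , F′⊆G , new = e-extend {G = G} {F} sub x∉W xa xb a≢b in begin
      n                                ≡⟨ m+[n∸m]≡n 2≤n ⟨
      2 + (n ∸ 2)                      ≡⟨ cong (2 +_) (∣allBut-pair∣ x≢w) ⟨
      2 + ∣ allBut (x ∷ w ∷ []) ∣      ≤⟨ s≤s (s≤s (p⊆q⇒∣p∣≤∣q∣ S⊆W)) ⟩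
      2 + ∣ W ∣                        ≤⟨ s≤s (s≤s ∣W∣≤) ⟩
      3 + e F                          ≡⟨ cong suc size ⟨
      suc (e F′)                       ≡⟨ e-addEdge F′ w≢c (¬wc F′ new) ⟨
      e (addEdge F′ w≢c)               ≤⟨ e-mono {F = addEdge F′ w≢c} {G} (addEdge-⊆ F′ w≢c {H = G} F′⊆G wc) ⟩
      e G                              ∎
      where
      w≢c : w ≢ c
      w≢c = Adj⇒≢ {G = G} wc
      ¬wc : ∀ (F′ : Graph n) →
            (∀ {u v} → Adj F′ u v → Adj F u v ⊎ (u ≡ x ⊎ v ≡ x)) → ¬ Adj F′ w c
      ¬wc _ new wc′ with new wc′
      ... | inj₁ wc″        = w∉W (proj₁ (proj₂ (sub _ _ wc″)))
      ... | inj₂ (inj₁ w≡x) = x≢w (sym w≡x)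
      ... | inj₂ (inj₂ c≡x) = c≢x c≡x

-- As ℓ ≤ n ∸ 2, some vertex lies outside the closed neighbourhood of `x`. A walk to it leaves that
-- neighbourhood along an edge `ab`, where `a` cannot be `x`; so `a` is adjacent to both `x` and
-- `b`, and `two-branching⇒n≤e` applies to `x` and `a`.
n≤e : ∀ {n ℓ} {G : Graph n} → 4 ≤ n → 2 ≤ ℓ → ℓ ≤ n ∸ 2 → ℋ (n ∸ 2) n ℓ (n ∸ 2) G → n ≤ e G
n≤e {n} {ℓ} {G} 4≤n 2≤ℓ ℓ≤ (Δ≡ℓ , diam≤) = uncurry at-vertex (Δ≡⁻ {G = G} (≤-trans (n≤1+n 1) 2≤ℓ) Δ≡ℓ)
  where
  at-vertex : ∀ x → degree G x ≡ ℓ → n ≤ e G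
  at-vertex x deg≡ =
    let v , v∉ = ∉-fresh (x ∷ elements (lookup (nbhd G) x)) deg<
        a , b , (ab , _) , near-a , ¬near-b = crossing (λ u → (u Fin.≟ x) ⊎-dec adj? G x u)
          (sdiam⇒conn {G = G} diam≤ 4≤n (∈⊤ {x = x}) (∈⊤ {x = v})) (inj₁ refl)
          [ v∉ ∘ here , v∉ ∘ there ∘ ∈-elements⁺ ]′
    in leaving ab near-a ¬near-b
    where
    deg< : suc (length (elements (lookup (nbhd G) x))) < n
    deg< = begin-strict
      suc (length (elements (lookup (nbhd G) x))) ≡⟨ cong suc (trans (length-elements (lookup (nbhd G) x)) deg≡) ⟩
      suc ℓ                                       ≤⟨ s≤s ℓ≤ ⟩
      suc (n ∸ 2)                                 <⟨ n<1+n _ ⟩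
      2 + (n ∸ 2)                                 ≡⟨ m+[n∸m]≡n (≤-trans (s≤s (s≤s z≤n)) 4≤n) ⟩
      n                                           ∎
      where open ≤-Reasoning
    leaving : ∀ {a b} → Adj G a b → a ≡ x ⊎ Adj G x a → ¬ (b ≡ x ⊎ Adj G x b) → n ≤ e G
    leaving ab (inj₁ refl) ¬near-b = contradiction (inj₂ ab) ¬near-b
    leaving ab (inj₂ xa)   ¬near-b = two-branching⇒n≤e {G = G} 4≤n diam≤ (Adj⇒≢ {G = G} xa)
      (degree≥2⇒HasTwo {G = G} (subst (2 ≤_) (sym deg≡) 2≤ℓ))
      (_ , _ , Adj-sym {G = G} xa , ab , ¬near-b ∘ inj₁ ∘ sym)

⊆∧∣∣≥⇒⊇ : ∀ {n} {S W : Subset n} → S ⊆ W → ∣ W ∣ ≤ ∣ S ∣ → ∀ {x} → x ∈ W → x ∈ S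
⊆∧∣∣≥⇒⊇ {S = S} S⊆W ∣W∣≤∣S∣ {x} x∈W with x ∈? S
... | yes x∈S = x∈S
... | no  x∉S = contradiction ∣W∣≤∣S∣ (<⇒≱ (p⊂q⇒∣p∣<∣q∣ (S⊆W , x , x∈W , x∉S)))

module _ {n} {G : Graph n} (5≤n : 5 ≤ n) (diam≤ : sdiam (n ∸ 2) G ≤⁺ [ n ∸ 3 ]) where

  private
    3≤n : 3 ≤ n
    3≤n = ≤-trans (s≤s (s≤s (s≤s z≤n))) 5≤n

  -- A Steiner tree with at most `n ∸ 3` edges has at most `n ∸ 2` vertices, so it spans exactly `S`
  -- and avoids `x` and `y`. Its first edge on the way from `v` to another vertex of `S` ends in the
  -- required neighbour.
  neighbour∉ : ∀ {v x y} → x ≢ y → v ≢ x → v ≢ y → ∃[ b ] (Adj G v b × b ≢ x × b ≢ y)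
  neighbour∉ {v} {x} {y} x≢y v≢x v≢y =
    let W , F , (sub , conn , S⊆W) , eF≤ = sdiam≤⁻ {G = G} diam≤ S (∣allBut-pair∣ x≢y)
        u , u∉ = ∉-fresh (v ∷ x ∷ y ∷ []) (≤-trans (n≤1+n 4) 5≤n)
        b , vb = first-step (u∉ ∘ here ∘ sym)
                   (conn v u (S⊆W v∈S) (S⊆W (∈-allBut⁺ (x ∷ y ∷ []) (u∉ ∘ there))))
        b∉ = ∈-allBut⁻ (x ∷ y ∷ []) (⊆∧∣∣≥⇒⊇ S⊆W (∣W∣≤∣S∣ {W} {F} sub conn S⊆W eF≤) (proj₂ (proj₂ (sub _ _ vb))))
    in b , proj₁ (sub _ _ vb) , b∉ ∘ here , b∉ ∘ there ∘ here
    where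
    S : Subset n
    S = allBut (x ∷ y ∷ [])
    v∈S : v ∈ S
    v∈S = ∈-allBut⁺ (x ∷ y ∷ []) (∉pair v≢x v≢y)
    ∣W∣≤∣S∣ : ∀ {W F} → IsSubgraph G (W , F) → IsConnected (W , F) → S ⊆ W → e F ≤ n ∸ 3 →
              ∣ W ∣ ≤ ∣ S ∣
    ∣W∣≤∣S∣ {W} {F} sub conn S⊆W eF≤ = begin
      ∣ W ∣        ≤⟨ conn⇒∣W∣≤ {G = F} (connected-subgraph {G = G} {F} sub conn) (S⊆W v∈S) ⟩
      suc (e F)    ≤⟨ s≤s eF≤ ⟩
      suc (n ∸ 3)  ≡⟨ +-∸-assoc 1 3≤n ⟨
      n ∸ 2        ≡⟨ ∣allBut-pair∣ x≢y ⟨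
      ∣ S ∣        ∎
      where open ≤-Reasoning

  -- Deleting two neighbours of `v` must leave it a third. The neighbours `a`, `b`, `c` are found in
  -- turn, each after deleting those found so far; `x` and `y` fill up the deleted pairs.
  3≤degree : ∀ v → 3 ≤ degree G v
  3≤degree v =
    let x , x∉ = ∉-fresh (v ∷ []) (≤-trans (s≤s (s≤s z≤n)) 5≤n)
        y , y∉ = ∉-fresh (v ∷ x ∷ []) 3≤n
        a , va , a≢x , a≢y = neighbour∉ (y∉ ∘ there ∘ here ∘ sym) (x∉ ∘ here ∘ sym) (y∉ ∘ here ∘ sym)
        b , vb , b≢a , b≢x = neighbour∉ a≢x (Adj⇒≢ {G = G} va) (x∉ ∘ here ∘ sym)
        c , vc , c≢a , c≢b = neighbour∉ (b≢a ∘ sym) (Adj⇒≢ {G = G} va) (Adj⇒≢ {G = G} vb)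
    in ≤degree {G = G} {xs = c ∷ a ∷ b ∷ []}
         ((c≢a ∷ c≢b ∷ []) ∷ pair! (b≢a ∘ sym))
         λ { (here refl) → vc ; (there (here refl)) → va ; (there (there (here refl))) → vb }

  -- Each vertex outside `xs` contributes at least 3. With a single vertex of degree ℓ this bounds
  -- the size from below; with the hub and a rim vertex of the ladder it bounds the rim degree from
  -- above.
  degree-sum : ∀ {xs} → Unique xs → sum (map (degree G) xs) + n * 3 ≤ e G + e G + length xs * 3
  degree-sum {xs} xs! = begin
    sum (map (degree G) xs) + n * 3
      ≡⟨ cong (λ l → sum (map (degree G) xs) + l * 3) (length-tabulate {n = n} id) ⟨
    sum (map (degree G) xs) + length (allFin n) * 3
      ≤⟨ sum-⊆ 3≤degree xs! (λ {x} _ → ∈-allFin x) ⟩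
    sum (map (degree G) (allFin n)) + length xs * 3
      ≤⟨ +-monoˡ-≤ _ (handshake G) ⟩
    e G + e G + length xs * 3
      ∎
    where open ≤-Reasoning

-- Graphs given by a list of edges between numbers

Link : List (ℕ × ℕ) → ℕ → ℕ → Set
Link L a b = (a , b) ∈ᴸ L ⊎ (b , a) ∈ᴸ L

Link-sym : ∀ {L a b} → Link L a b → Link L b a
Link-sym = Sum.swap

-- Loops and numbers that are too large are ignored.
module _ (n : ℕ) (L : List (ℕ × ℕ)) where

  private
    R : Fin n → Fin n → Set
    R u v = u ≢ v × Link L (toℕ u) (toℕ v)

    R? : ∀ u v → Dec (R u v)
    R? u v = ¬? (u Fin.≟ v) ×-dec (member? _≟²_ (toℕ u , toℕ v) L ⊎-dec member? _≟²_ (toℕ v , toℕ u) L)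
      where _≟²_ = ≡-dec _≟_ _≟_

    R-sym : ∀ {u v} → R u v → R v u
    R-sym (u≢v , uv) = u≢v ∘ sym , Link-sym {L} uv

    R-irrefl : ∀ {u} → ¬ R u u
    R-irrefl (u≢u , _) = u≢u refl

  opaque
    fromEdges : Graph n
    fromEdges = fromRelation R? R-sym R-irrefl

    fromEdges⁺ : ∀ {u v} → u ≢ v → Link L (toℕ u) (toℕ v) → Adj fromEdges u v
    fromEdges⁺ u≢v uv = Adj-fromRelation⁺ R? R-sym R-irrefl (u≢v , uv)

    fromEdges⁻ : ∀ {u v} → Adj fromEdges u v → Link L (toℕ u) (toℕ v)
    fromEdges⁻ uv = proj₂ (Adj-fromRelation⁻ R? R-sym R-irrefl uv)

  e-fromEdges : e fromEdges ≤ length L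
  e-fromEdges = e≤length {G = fromEdges} L fromEdges⁻

  degree-fromEdges≤ : ∀ {v} xs → (∀ {b} → b < n → toℕ v ≢ b → Link L (toℕ v) b → b ∈ᴸ xs) →
                      degree fromEdges v ≤ length xs
  degree-fromEdges≤ {v} xs cover = subst (_≤ length xs)
    (trans (length-map toℕ nbrs) (length-elements (lookup (nbhd fromEdges) v)))
    (Unique-⊆⇒length≤ (Unique.map⁺ Fin.toℕ-injective (elements! (lookup (nbhd fromEdges) v))) in-xs)
    where
    nbrs : List (Fin n)
    nbrs = elements (lookup (nbhd fromEdges) v)
    in-xs : map toℕ nbrs ⊆ᴸ xs
    in-xs b∈ with ∈-map⁻ toℕ b∈
    ... | u , u∈ , refl = let vu = ∈-elements⁻ {p = lookup (nbhd fromEdges) v} u∈ in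
      cover (Fin.toℕ<n u) (Adj⇒≢ {G = fromEdges} vu ∘ Fin.toℕ-injective) (fromEdges⁻ vu)

  degree-fromEdges≥ : ∀ {v xs} → Unique xs →
                      (∀ {b} → b ∈ᴸ xs → b < n × toℕ v ≢ b × Link L (toℕ v) b) →
                      length xs ≤ degree fromEdges v
  degree-fromEdges≥ {v} {xs} xs! link = subst (length xs ≤_)
    (trans (length-map toℕ nbrs) (length-elements (lookup (nbhd fromEdges) v)))
    (Unique-⊆⇒length≤ xs! in-nbrs)
    where
    nbrs : List (Fin n)
    nbrs = elements (lookup (nbhd fromEdges) v)
    in-nbrs : xs ⊆ᴸ map toℕ nbrs
    in-nbrs {b} b∈ = let b<n , v≢b , vb = link b∈
                         b≡ = Fin.toℕ-fromℕ< b<n in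
      subst (_∈ᴸ map toℕ nbrs) b≡ (∈-map⁺ toℕ (∈-elements⁺ {p = lookup (nbhd fromEdges) v}
        (fromEdges⁺ (λ v≡ → v≢b (trans (cong toℕ v≡) b≡)) (subst (Link L (toℕ v)) (sym b≡) vb))))

  -- Steps that avoid the numbers in ds; only the end of a step is tested.
  record Step (ds : List ℕ) (a b : ℕ) : Set where
    constructor step
    field
      a≢b  : a ≢ b
      link : Link L a b
      b<n  : b < n
      b∉ds : b ∉ᴸ ds

  -- Walks are built between plain numbers, where arithmetic on vertices is available, and carried
  -- to `Fin n` here. The start of each step is known to survive from the step before.
  steps⇒inside : ∀ {xs : List (Fin n)} {u c a b} → toℕ u ≡ a → toℕ c ≡ b → u ∈ allBut xs →
                 Star (Step (map toℕ xs)) a b → Star (Inside fromEdges (allBut xs)) u c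
  steps⇒inside u≡a c≡a u∈ ε = subst (Star _ _) (Fin.toℕ-injective (trans u≡a (sym c≡a))) ε
  steps⇒inside {xs} {u} refl c≡b u∈ (step u≢w link w<n w∉ ◅ steps) =
    (fromEdges⁺ (λ u≡w → u≢w (trans (cong toℕ u≡w) w≡)) (subst (Link L (toℕ u)) (sym w≡) link) , u∈ , w∈)
      ◅ steps⇒inside w≡ c≡b w∈ steps
    where
    w≡ = Fin.toℕ-fromℕ< w<n
    w∈ : Fin.fromℕ< w<n ∈ allBut xs
    w∈ = ∈-allBut⁺ xs λ w∈xs → w∉ (subst (_∈ᴸ map toℕ xs) w≡ (∈-map⁺ toℕ w∈xs))

-- Brooms and lollipops

-- The star with centre 0 and leaves 1 … ℓ, extended by the path ℓ … ℓ + k; for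
-- c ≡ 1 the end of the path is joined to the centre.
broomEdges : (ℓ k c : ℕ) → List (ℕ × ℕ)
broomEdges ℓ k c =
  applyUpTo (λ i → 0 , suc i) ℓ ++ applyUpTo (λ i → ℓ + i , suc (ℓ + i)) k ++ replicate c (ℓ + k , 0)

∈-replicate⁺ : ∀ {A : Set} {x : A} n → 1 ≤ n → x ∈ᴸ replicate n x
∈-replicate⁺ (suc n) _ = here refl

∈-replicate⁻ : ∀ {A : Set} {x y : A} n → y ∈ᴸ replicate n x → 1 ≤ n × y ≡ x
∈-replicate⁻ (suc n) (here eq) = s≤s z≤n , eq
∈-replicate⁻ (suc n) (there y∈) = s≤s z≤n , proj₂ (∈-replicate⁻ n y∈)

replicate! : ∀ {A : Set} {x : A} {c} → c ≤ 1 → Unique (replicate c x)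
replicate! {c = 0}     _ = []
replicate! {c = suc 0} _ = [] ∷ []
replicate! {c = suc (suc _)} (s≤s ())

module Broom (ℓ k c : ℕ) where

  private
    n : ℕ
    n = suc (ℓ + k)
    L : List (ℕ × ℕ)
    L = broomEdges ℓ k c

  data Edge : ℕ → ℕ → Set where
    spoke : ∀ {b} → 1 ≤ b → b ≤ ℓ → Edge 0 b
    path  : ∀ {a} → ℓ ≤ a → a < ℓ + k → Edge a (suc a)
    loop  : ∀ {a} → a ≡ ℓ + k → 1 ≤ c → Edge a 0

  ∈⇒Edge : ∀ {a b} → (a , b) ∈ᴸ L → Edge a b
  ∈⇒Edge ab∈ with ∈-++⁻ (applyUpTo (λ i → 0 , suc i) ℓ) ab∈
  ... | inj₁ ab∈₁ with ∈-applyUpTo⁻ (λ i → 0 , suc i) ab∈₁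
  ...   | i , i<ℓ , refl = spoke (s≤s z≤n) i<ℓ
  ∈⇒Edge ab∈ | inj₂ ab∈′ with ∈-++⁻ (applyUpTo (λ i → ℓ + i , suc (ℓ + i)) k) ab∈′
  ... | inj₁ ab∈₂ with ∈-applyUpTo⁻ (λ i → ℓ + i , suc (ℓ + i)) ab∈₂
  ...   | i , i<k , refl = path (m≤m+n ℓ i) (+-monoʳ-< ℓ i<k)
  ∈⇒Edge ab∈ | inj₂ ab∈′ | inj₂ ab∈₃ with ∈-replicate⁻ c ab∈₃
  ... | 1≤c , refl = loop refl 1≤c

  Edge⇒∈ : ∀ {a b} → Edge a b → (a , b) ∈ᴸ L
  Edge⇒∈ (spoke {suc i} _ i<ℓ) = ∈-++⁺ˡ (∈-applyUpTo⁺ (λ i → 0 , suc i) i<ℓ)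
  Edge⇒∈ (path {a} ℓ≤a a<) = ∈-++⁺ʳ (applyUpTo (λ i → 0 , suc i) ℓ)
    (∈-++⁺ˡ (subst (λ a → (a , suc a) ∈ᴸ applyUpTo (λ i → ℓ + i , suc (ℓ + i)) k) (m+[n∸m]≡n ℓ≤a)
      (∈-applyUpTo⁺ (λ i → ℓ + i , suc (ℓ + i))
        (+-cancelˡ-< ℓ _ _ (subst (_< ℓ + k) (sym (m+[n∸m]≡n ℓ≤a)) a<)))))
  Edge⇒∈ (loop refl 1≤c) = ∈-++⁺ʳ (applyUpTo (λ i → 0 , suc i) ℓ)
    (∈-++⁺ʳ (applyUpTo (λ i → ℓ + i , suc (ℓ + i)) k) (∈-replicate⁺ c 1≤c))

  graph : Graph n
  graph = fromEdges n L

  e-graph : e graph ≤ ℓ + k + c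
  e-graph = subst (e graph ≤_) len (e-fromEdges n L)
    where
    open ≡-Reasoning
    star = applyUpTo (λ i → 0 , suc i) ℓ
    tail = applyUpTo (λ i → ℓ + i , suc (ℓ + i)) k
    len : length L ≡ ℓ + k + c
    len = begin
      length L
        ≡⟨ trans (length-++ star) (cong (length star +_) (length-++ tail)) ⟩
      length star + (length tail + length (replicate c (ℓ + k , 0)))
        ≡⟨ cong₂ _+_ (length-applyUpTo _ ℓ) (cong₂ _+_ (length-applyUpTo _ k) (length-replicate c)) ⟩
      ℓ + (k + c)
        ≡⟨ +-assoc ℓ k c ⟨
      ℓ + k + c
        ∎

  hub-neighbours : List ℕ
  hub-neighbours = applyUpTo suc ℓ ++ replicate c (ℓ + k)

  length-hub-neighbours : length hub-neighbours ≡ ℓ + c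
  length-hub-neighbours = trans (length-++ (applyUpTo suc ℓ)) (cong₂ _+_ (length-applyUpTo suc ℓ) (length-replicate c))

  degree-hub≤ : 1 ≤ ℓ → degree graph zero ≤ ℓ + c
  degree-hub≤ 1≤ℓ = subst (degree graph zero ≤_) length-hub-neighbours
    (degree-fromEdges≤ n L hub-neighbours λ
      { _ 0≢b (inj₁ 0b) → out 0≢b (∈⇒Edge 0b)
      ; _ 0≢b (inj₂ b0) → into 0≢b (∈⇒Edge b0) })
    where
    out : ∀ {b} → 0 ≢ b → Edge 0 b → b ∈ᴸ hub-neighbours
    out _   (spoke {suc i} _ i<ℓ) = ∈-++⁺ˡ (∈-applyUpTo⁺ suc i<ℓ)
    out _   (path ℓ≤0 _)          = contradiction (≤-trans 1≤ℓ ℓ≤0) λ ()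
    out 0≢b (loop _ _)            = contradiction refl 0≢b
    into : ∀ {b} → 0 ≢ b → Edge b 0 → b ∈ᴸ hub-neighbours
    into 0≢b (spoke _ _) = contradiction refl 0≢b
    into _   (loop refl 1≤c)  = ∈-++⁺ʳ (applyUpTo suc ℓ) (∈-replicate⁺ c 1≤c)

  -- For `k ≡ 0` the closing edge would coincide with the spoke to `ℓ` and add nothing to the
  -- degree; the last hypothesis excludes this.
  degree-hub≥ : 1 ≤ ℓ → c ≤ 1 → (1 ≤ c → 1 ≤ k) → ℓ + c ≤ degree graph zero
  degree-hub≥ 1≤ℓ c≤1 1≤k = subst (_≤ degree graph zero) length-hub-neighbours
    (degree-fromEdges≥ n L
      (Unique.++⁺ (Unique.applyUpTo⁺₁ suc ℓ (λ i<j _ → <⇒≢ i<j ∘ suc-injective)) (replicate! c≤1) disjoint) link)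
    where
    disjoint : Disjoint (applyUpTo suc ℓ) (replicate c (ℓ + k))
    disjoint (b∈ , b∈′) with ∈-applyUpTo⁻ suc b∈ | ∈-replicate⁻ c b∈′
    ... | i , i<ℓ , refl | 1≤c , eq = <⇒≢ (≤-<-trans i<ℓ (m<m+n ℓ (1≤k 1≤c))) eq
    link : ∀ {b} → b ∈ᴸ hub-neighbours → b < n × 0 ≢ b × Link L 0 b
    link b∈ with ∈-++⁻ (applyUpTo suc ℓ) b∈
    ... | inj₁ b∈′ with ∈-applyUpTo⁻ suc b∈′
    ...   | i , i<ℓ , refl = s≤s (≤-trans i<ℓ (m≤m+n ℓ k)) , (λ ()) , inj₁ (Edge⇒∈ (spoke (s≤s z≤n) i<ℓ))
    link b∈ | inj₂ b∈′ with ∈-replicate⁻ c b∈′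
    ... | 1≤c , refl = n<1+n _ , (λ 0≡ → <⇒≢ (≤-trans 1≤ℓ (m≤m+n ℓ k)) 0≡) , inj₂ (Edge⇒∈ (loop refl 1≤c))

  degree-other≤2 : ∀ {v} → toℕ v ≢ 0 → degree graph v ≤ 2
  degree-other≤2 {v} v≢0 with toℕ v in v≡
  ... | zero  = contradiction refl v≢0
  ... | suc a = degree-fromEdges≤ n L neighbours (λ b<n _ → cover v≡ b<n)
    where
    -- The edges are oriented so that `suc a` has at most one incoming edge, from the hub or from
    -- its predecessor on the path, and at most one outgoing edge, whose only possible end is
    -- `after`.
    before : Dec (suc a ≤ ℓ) → ℕ
    before (yes _) = 0
    before (no  _) = a
    after : Dec (suc a ≡ ℓ + k) → ℕ
    after (yes _) = 0
    after (no  _) = suc (suc a)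
    out : ∀ {b} d → b < n → Edge (suc a) b → b ≡ after d
    out (yes eq) _ (path _ a<)  = contradiction eq (<⇒≢ a<)
    out (no  _)  _ (path _ _)   = refl
    out (yes _)  _ (loop _ _)   = refl
    out (no ¬eq) _ (loop eq _)  = contradiction eq ¬eq
    into : ∀ {b} d → Edge b (suc a) → b ≡ before d
    into (yes _)   (spoke _ _)    = refl
    into (no a≰ℓ)  (spoke _ a≤ℓ)  = contradiction a≤ℓ a≰ℓ
    into (yes a<ℓ) (path ℓ≤a _)   = contradiction ℓ≤a (<⇒≱ a<ℓ)
    into (no  _)   (path _ _)     = refl
    neighbours : List ℕ
    neighbours = before (suc a ≤? ℓ) ∷ after (suc a ≟ ℓ + k) ∷ []
    cover : ∀ {x b} → x ≡ suc a → b < n → Link L x b → b ∈ᴸ neighbours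
    cover refl b<n (inj₁ ab) = there (here (out (suc a ≟ ℓ + k) b<n (∈⇒Edge ab)))
    cover refl b<n (inj₂ ba) = here (into (suc a ≤? ℓ) (∈⇒Edge ba))

  Δ-graph : 1 ≤ ℓ → 2 ≤ ℓ + c → c ≤ 1 → (1 ≤ c → 1 ≤ k) → Δ graph ≡ ℓ + c
  Δ-graph 1≤ℓ 2≤ c≤1 1≤k = Δ≡⁺ {G = graph} zero (≤-antisym (degree-hub≤ 1≤ℓ) (degree-hub≥ 1≤ℓ c≤1 1≤k)) deg≤
    where
    deg≤ : ∀ v → degree graph v ≤ ℓ + c
    deg≤ zero    = degree-hub≤ 1≤ℓ
    deg≤ (suc v) = ≤-trans (degree-other≤2 λ ()) 2≤

  module _ {ds : List ℕ} (0∉ds : 0 ∉ᴸ ds) where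

    to-hub : ∀ {a} → a ≤ ℓ → Star (Step n L ds) a 0
    to-hub {zero}  _    = ε
    to-hub {suc a} a<ℓ = step (λ ()) (inj₂ (Edge⇒∈ (spoke (s≤s z≤n) a<ℓ))) (s≤s z≤n) 0∉ds ◅ ε

    down : ∀ {a} → a < n → (∀ {b} → b < a → b ∉ᴸ ds) → Star (Step n L ds) a 0
    down {zero}  _   _ = ε
    down {suc a} a<n alive with suc a ≤? ℓ
    ... | yes a<ℓ = to-hub a<ℓ
    ... | no  a≮ℓ = step (1+n≢n) (inj₂ (Edge⇒∈ (path (≮⇒≥ a≮ℓ) (s≤s⁻¹ a<n)))) (<-trans (n<1+n a) a<n) (alive (n<1+n a))
      ◅ down (<-trans (n<1+n a) a<n) (λ b<a → alive (<-trans b<a (n<1+n a)))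

    -- This is the other way round the cycle: on to the end of the path and back through the closing
    -- edge. The number `j` of path edges still ahead drives the recursion.
    up : 1 ≤ c → ∀ j {a} → ℓ ≤ a → a + j ≡ ℓ + k → (∀ {b} → a < b → b ∉ᴸ ds) → Star (Step n L ds) a 0
    up 1≤c zero {zero}  _ _  _ = ε
    up 1≤c zero {suc a} _ eq _ =
      step (λ ()) (subst (λ x → Link L x 0) (trans (sym eq) (+-identityʳ _)) (inj₁ (Edge⇒∈ (loop refl 1≤c))))
           (s≤s z≤n) 0∉ds ◅ ε
    up 1≤c (suc j) {a} ℓ≤a eq alive = step (1+n≢n ∘ sym) (inj₁ (Edge⇒∈ (path ℓ≤a a<))) (s≤s a<) (alive (n<1+n a))
      ◅ up 1≤c j (≤-trans ℓ≤a (n≤1+n a)) (trans (sym (+-suc a j)) eq) (λ a<b → alive (<-trans (n<1+n a) a<b))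
      where
      a< : a < ℓ + k
      a< = subst (a <_) eq (m<m+n a (s≤s z≤n))

∣allBut-[]∣ : ∀ {n} → ∣ allBut {n} [] ∣ ≡ n
∣allBut-[]∣ = trans (sym (+-identityʳ _)) (∣allBut∣+length [] [])

∈-allBut-[] : ∀ {n} {x : Fin n} → x ∈ allBut []
∈-allBut-[] = ∈-allBut⁺ [] λ ()

module _ (ℓ k c : ℕ) where

  open Broom ℓ k c

  broom-sdiam≤n∸1 : sdiam (suc (ℓ + k) ∸ 2) graph ≤⁺ [ ℓ + k ]
  broom-sdiam≤n∸1 = sdiam≤⁺ {G = graph} λ S _ →
    allBut [] , (λ _ → ∈-allBut-[]) ,
    conn-from {G = graph} zero (λ {u} u∈ →
      steps⇒inside _ (broomEdges ℓ k c) {[]} refl refl u∈ (down (λ ()) (Fin.toℕ<n u) (λ _ ()))) ,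
    (zero , ∈-allBut-[]) , ≤-reflexive ∣allBut-[]∣

  -- Here no vertex but the centre is a cut vertex.
  broom-sdiam≤n∸2 : 2 ≤ suc (ℓ + k) → 1 ≤ c ⊎ k ≡ 0 → sdiam (suc (ℓ + k) ∸ 2) graph ≤⁺ [ suc (ℓ + k) ∸ 2 ]
  broom-sdiam≤n∸2 2≤n c≥1⊎k≡0 = sdiam≤⁺ {G = graph} λ S ∣S∣ →
    -- `S` has `n ∸ 2` elements, so even together with the centre it misses some `d`; deleting this
    -- one keeps the centre as root.
    let d , d∉ = ∉-fresh (zero ∷ elements S) (begin-strict
          suc (length (elements S))   ≡⟨ cong suc (trans (length-elements S) ∣S∣) ⟩
          suc (suc (ℓ + k) ∸ 2)       <⟨ n<1+n _ ⟩
          2 + (suc (ℓ + k) ∸ 2)       ≡⟨ m+[n∸m]≡n 2≤n ⟩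
          suc (ℓ + k)                 ∎)
        0∉ = λ { (here 0≡d) → d∉ (here (sym 0≡d)) }
    in allBut (d ∷ []) ,
       (λ x∈ → ∈-allBut⁺ (d ∷ []) λ { (here refl) → d∉ (there (∈-elements⁺ x∈)) }) ,
       conn-from {G = graph} zero (λ {u} u∈ → steps⇒inside _ (broomEdges ℓ k c) {d ∷ []} refl refl u∈
         (avoiding (Fin.toℕ<n u) (λ { (here 0≡d) → 0∉ (here (Fin.toℕ-injective 0≡d)) })
                   (λ u≡d → ∈-allBut⁻ (d ∷ []) u∈ (here (Fin.toℕ-injective u≡d))))) ,
       (zero , ∈-allBut⁺ (d ∷ []) 0∉) ,
       ≤-reflexive (suc-injective (begin-equality
         suc ∣ allBut (d ∷ []) ∣   ≡⟨ trans (+-comm 1 _) (∣allBut∣+length (d ∷ []) ([] ∷ [])) ⟩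
         suc (ℓ + k)               ≡⟨ m+[n∸m]≡n 2≤n ⟨
         2 + (suc (ℓ + k) ∸ 2)     ∎))
    where
    open ≤-Reasoning
    -- If `d` lies above `a`, the path down to the star is free. If it lies below, a leaf of the
    -- star is still adjacent to the centre, and a vertex of the path goes round by the closing
    -- edge.
    avoiding : ∀ {a d} → a < suc (ℓ + k) → 0 ∉ᴸ d ∷ [] → a ≢ d →
               Star (Step (suc (ℓ + k)) (broomEdges ℓ k c) (d ∷ [])) a 0
    avoiding {a} {d} a<n 0∉ a≢d with <-cmp a d | a ≤? ℓ
    ... | tri< a<d _ _ | _       = down 0∉ a<n λ { b<a (here refl) → <-asym a<d b<a }
    ... | tri≈ _ a≡d _ | _       = contradiction a≡d a≢d
    ... | tri> _ _ _   | yes a≤ℓ = to-hub 0∉ a≤ℓ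
    ... | tri> _ _ d<a | no  a≰ℓ = beyond c≥1⊎k≡0
      where
      beyond : 1 ≤ c ⊎ k ≡ 0 → Star (Step (suc (ℓ + k)) (broomEdges ℓ k c) (d ∷ [])) a 0
      beyond (inj₁ 1≤c) = up 0∉ 1≤c (ℓ + k ∸ a) (≰⇒≥ a≰ℓ) (m+[n∸m]≡n (s≤s⁻¹ a<n))
        λ { a<b (here refl) → <-asym d<a a<b }
      beyond (inj₂ k≡0) = contradiction
        (≤-trans (s≤s⁻¹ a<n) (≤-reflexive (trans (cong (ℓ +_) k≡0) (+-identityʳ ℓ)))) a≰ℓ

-- Minimum sizes for the diameter bounds n ∸ 1 and n ∸ 2

eMin[n∸1] : ∀ n ℓ → 5 ≤ n → 2 ≤ ℓ → ℓ ≤ n ∸ 1 → eMin (n ∸ 2) n ℓ (n ∸ 1) ≡ [ n ∸ 1 ]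
eMin[n∸1] (suc m) ℓ 5≤n 2≤ℓ ℓ≤m = let k , ℓ+k≡m = m≤n⇒∃[o]m+o≡n ℓ≤m in broom k ℓ+k≡m
  where
  broom : ∀ k → ℓ + k ≡ m → eMin (suc m ∸ 2) (suc m) ℓ m ≡ [ m ]
  broom k refl = eMin≡ graph
    (trans (Δ-graph (<⇒≤ 2≤ℓ) (≤-trans 2≤ℓ (m≤m+n ℓ 0)) z≤n (λ ())) (+-identityʳ ℓ) , broom-sdiam≤n∸1 ℓ k 0)
    (≤-trans e-graph (≤-reflexive (+-identityʳ (ℓ + k))))
    (λ H (_ , diam≤) → s≤s⁻¹ (n≤1+e {G = H} diam≤ (<⇒≤ 5≤n)))
    where open Broom ℓ k 0

eMin[n∸2]-star : ∀ n → 5 ≤ n → eMin (n ∸ 2) n (n ∸ 1) (n ∸ 2) ≡ [ n ∸ 1 ]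
-- The star is the broom with a path of length 0. Its order is `suc (m + 0)`, so the result is
-- proved for that order and transported.
eMin[n∸2]-star (suc m) 5≤n = subst (λ m′ → eMin (suc m′ ∸ 2) (suc m′) m (suc m′ ∸ 2) ≡ [ m′ ]) (+-identityʳ m) (eMin≡ graph
  (trans (Δ-graph (≤-trans (s≤s z≤n) 4≤m) (≤-trans (≤-trans (s≤s (s≤s z≤n)) 4≤m) (m≤m+n m 0)) z≤n (λ ())) (+-identityʳ m)
    , broom-sdiam≤n∸2 m 0 0 (s≤s (≤-trans (s≤s z≤n) (≤-trans 4≤m (m≤m+n m 0)))) (inj₂ refl))
  (≤-trans e-graph (≤-reflexive (+-identityʳ (m + 0))))
  (λ H (_ , diam≤) → s≤s⁻¹ (n≤1+e {G = H} diam≤ (≤-trans 4≤m (≤-trans (m≤m+n m 0) (n≤1+n _))))))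
  where
  open Broom m 0 0
  4≤m : 4 ≤ m
  4≤m = s≤s⁻¹ 5≤n

eMin[n∸2] : ∀ n ℓ → 5 ≤ n → 2 ≤ ℓ → ℓ ≤ n ∸ 2 → eMin (n ∸ 2) n ℓ (n ∸ 2) ≡ [ n ]
eMin[n∸2] (suc m) (suc ℓ) 5≤n 2≤ℓ ℓ≤ =
  -- The closing edge supplies the last unit of the degree `suc ℓ` of the hub, so the star has only
  -- `ℓ` leaves.
  let k , ℓ+k≡m = m≤n⇒∃[o]m+o≡n (≤-trans (<⇒≤ ℓ≤) (m∸n≤m m 1)) in lollipop k ℓ+k≡m
  where
  1≤ℓ : 1 ≤ ℓ
  1≤ℓ = s≤s⁻¹ 2≤ℓ
  lollipop : ∀ k → ℓ + k ≡ m → eMin (suc m ∸ 2) (suc m) (suc ℓ) (suc m ∸ 2) ≡ [ suc m ]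
  lollipop k refl = eMin≡ graph
    (trans (Δ-graph 1≤ℓ (≤-trans 2≤ℓ (≤-reflexive (+-comm 1 ℓ))) ≤-refl λ _ → 1≤k) (+-comm ℓ 1)
      , broom-sdiam≤n∸2 ℓ k 1 (≤-trans (s≤s (s≤s z≤n)) 5≤n) (inj₁ ≤-refl))
    (≤-trans e-graph (≤-reflexive (+-comm (ℓ + k) 1)))
    (λ H H∈ → n≤e {G = H} (<⇒≤ 5≤n) 2≤ℓ ℓ≤ H∈)
    where
    open Broom ℓ k 1
    1≤k : 1 ≤ k
    1≤k = +-cancelˡ-≤ ℓ 1 k (≤-trans (≤-reflexive (+-comm ℓ 1)) (≤-trans ℓ≤ (m∸n≤m (ℓ + k) 1)))

-- Wheels with a ladder in the rim

pigeonhole : ∀ {x y : ℕ} {P Q R : ℕ → Set} →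
             (∀ {c} → P c → ¬ Q c) → (∀ {c} → P c → ¬ R c) → (∀ {c} → Q c → ¬ R c) →
             Any P (x ∷ y ∷ []) → Any Q (x ∷ y ∷ []) → ¬ Any R (x ∷ y ∷ [])
pigeonhole PQ PR QR (here p)         (here q)         _                = PQ p q
pigeonhole PQ PR QR (here p)         (there (here q)) (here r)         = PR p r
pigeonhole PQ PR QR (here p)         (there (here q)) (there (here r)) = QR q r
pigeonhole PQ PR QR (there (here p)) (there (here q)) _                = PQ p q
pigeonhole PQ PR QR (there (here p)) (here q)         (here r)         = QR q r
pigeonhole PQ PR QR (there (here p)) (here q)         (there (here r)) = PR p r

-- The easy half of the fan version of Menger's theorem: two deleted vertices cannot meet three
-- pairwise disjoint zones. The zones hold the vertices of three routes, apart from their common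
-- ends.
clear-zone : ∀ {x y : ℕ} {P Q R : ℕ → Set} → Decidable P → Decidable Q → Decidable R →
             (∀ {c} → P c → ¬ Q c) → (∀ {c} → P c → ¬ R c) → (∀ {c} → Q c → ¬ R c) →
             {T : Set} → (¬ Any P (x ∷ y ∷ []) → T) → (¬ Any Q (x ∷ y ∷ []) → T) →
             (¬ Any R (x ∷ y ∷ []) → T) → T
clear-zone {x} {y} P? Q? R? PQ PR QR viaP viaQ viaR
  with Any.any? P? (x ∷ y ∷ []) | Any.any? Q? (x ∷ y ∷ []) | Any.any? R? (x ∷ y ∷ [])
... | no ¬p | _     | _     = viaP ¬p
... | yes _ | no ¬q | _     = viaQ ¬q
... | yes _ | yes _ | no ¬r = viaR ¬r
... | yes p | yes q | yes r = contradiction r (pigeonhole PQ PR QR p q)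

Between : ℕ → ℕ → ℕ → Set
Between a b c = a ≤ c × c ≤ b

between? : ∀ a b → Decidable (Between a b)
between? a b c = (a ≤? c) ×-dec (c ≤? b)

-- The hub is 0 and the rim is the cycle 1 … N.  The hub is joined to suc p, to
-- q = 2 + p and to q + p + 1 … last; the rungs of the ladder join a to q + a
-- for 1 ≤ a ≤ p.  For δ ≡ 1 the vertex N = suc last takes the spare edge to q.
module Ladder (p r δ N : ℕ) (N≡ : N ≡ 2 + p + p + r + δ) where

  q last n : ℕ
  q    = 2 + p
  last = q + p + r
  n    = suc N

  last≤N : last ≤ N
  last≤N = ≤-trans (m≤m+n last δ) (≤-reflexive (sym N≡))

  2≤N : 2 ≤ N
  2≤N = ≤-trans (s≤s (s≤s z≤n)) last≤N

  1≤N : 1 ≤ N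
  1≤N = <⇒≤ 2≤N

  hub-neighbours : List ℕ
  hub-neighbours = suc p ∷ q ∷ applyUpTo (λ i → suc (q + p + i)) r

  rim spokes chords spare L : List (ℕ × ℕ)
  rim    = applyUpTo (λ i → suc i , suc (suc i)) (N ∸ 1)
  spokes = map (0 ,_) hub-neighbours
  chords = applyUpTo (λ i → suc i , q + suc i) p
  spare  = replicate δ (N , q)
  L      = (N , 1) ∷ rim ++ spokes ++ chords ++ spare

  length-hub-neighbours : length hub-neighbours ≡ 2 + r
  length-hub-neighbours = cong (2 +_) (length-applyUpTo (λ i → suc (q + p + i)) r)

  length-L : length L ≡ N + (2 + r) + p + δ
  length-L = begin
    suc (length (rim ++ spokes ++ chords ++ spare))
      ≡⟨ cong suc (length-++ rim) ⟩
    suc (length rim) + length (spokes ++ chords ++ spare)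
      ≡⟨ cong₂ _+_ (trans (cong suc (length-applyUpTo (λ i → suc i , suc (suc i)) (N ∸ 1))) (m+[n∸m]≡n 1≤N)) (length-++ spokes) ⟩
    N + (length spokes + length (chords ++ spare))
      ≡⟨ cong (N +_) (cong₂ _+_ (trans (length-map {B = ℕ × ℕ} (0 ,_) hub-neighbours) length-hub-neighbours) (length-++ chords)) ⟩
    N + (2 + r + (length chords + length spare))
      ≡⟨ cong (λ l → N + (2 + r + l)) (cong₂ _+_ (length-applyUpTo (λ i → suc i , q + suc i) p) (length-replicate δ)) ⟩
    N + (2 + r + (p + δ))
      ≡⟨ trans (sym (+-assoc N (2 + r) (p + δ))) (sym (+-assoc (N + (2 + r)) p δ)) ⟩
    N + (2 + r) + p + δ
      ∎
    where open ≡-Reasoning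

  rim∈ : ∀ {a} → 1 ≤ a → a < N → (a , suc a) ∈ᴸ L
  rim∈ {suc a} _ a<N = there (∈-++⁺ˡ (∈-applyUpTo⁺ (λ i → suc i , suc (suc i)) (∸-monoˡ-≤ 1 a<N)))

  closing∈ : (N , 1) ∈ᴸ L
  closing∈ = here refl

  spoke∈ : ∀ {a} → a ∈ᴸ hub-neighbours → (0 , a) ∈ᴸ L
  spoke∈ a∈ = there (∈-++⁺ʳ rim (∈-++⁺ˡ (∈-map⁺ (0 ,_) a∈)))

  late-spoke : ∀ {a} → q + p < a → a ≤ last → a ∈ᴸ hub-neighbours
  late-spoke {a} qp<a a≤ = there (there (subst (_∈ᴸ applyUpTo (λ i → suc (q + p + i)) r) (m+[n∸m]≡n qp<a)
    (∈-applyUpTo⁺ (λ i → suc (q + p + i))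
      (+-cancelˡ-≤ (q + p) _ _ (≤-trans (≤-reflexive (trans (+-suc (q + p) _) (m+[n∸m]≡n qp<a))) a≤)))))

  chord∈ : ∀ {i} → i < p → (suc i , q + suc i) ∈ᴸ L
  chord∈ i<p = there (∈-++⁺ʳ rim (∈-++⁺ʳ spokes
    (∈-++⁺ˡ (∈-applyUpTo⁺ (λ i → suc i , q + suc i) i<p))))

  spare∈ : 1 ≤ δ → (N , q) ∈ᴸ L
  spare∈ 1≤δ = there (∈-++⁺ʳ rim (∈-++⁺ʳ spokes (∈-++⁺ʳ chords (∈-replicate⁺ δ 1≤δ))))

  -- The first components of all edges but the spokes are positive, as are all
  -- second components.
  hub-link : ∀ {b} → Link L 0 b → b ∈ᴸ hub-neighbours
  hub-link (inj₁ (here eq)) = contradiction (,-injectiveˡ eq) (<⇒≢ 1≤N)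
  hub-link (inj₁ (there 0b∈)) with ∈-++⁻ rim 0b∈
  ... | inj₁ ∈rim with ∈-applyUpTo⁻ (λ i → suc i , suc (suc i)) ∈rim
  ...   | _ , _ , ()
  hub-link (inj₁ (there 0b∈)) | inj₂ 0b∈′ with ∈-++⁻ spokes 0b∈′
  ... | inj₁ ∈spokes with ∈-map⁻ (0 ,_) ∈spokes
  ...   | _ , b∈ , refl = b∈
  hub-link (inj₁ (there 0b∈)) | inj₂ 0b∈′ | inj₂ 0b∈″ with ∈-++⁻ chords 0b∈″
  ... | inj₁ ∈chords with ∈-applyUpTo⁻ (λ i → suc i , q + suc i) ∈chords
  ...   | _ , _ , ()
  hub-link (inj₁ (there 0b∈)) | inj₂ 0b∈′ | inj₂ 0b∈″ | inj₂ ∈spare with ∈-replicate⁻ δ ∈spare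
  ... | _ , eq = contradiction (,-injectiveˡ eq) (<⇒≢ 1≤N)
  hub-link (inj₂ (there b0∈)) with ∈-++⁻ rim b0∈
  ... | inj₁ ∈rim with ∈-applyUpTo⁻ (λ i → suc i , suc (suc i)) ∈rim
  ...   | _ , _ , ()
  hub-link (inj₂ (there b0∈)) | inj₂ b0∈′ with ∈-++⁻ spokes b0∈′
  ... | inj₁ ∈spokes with ∈-map⁻ (0 ,_) ∈spokes
  ...   | _ , here () , refl
  ...   | _ , there (here ()) , refl
  ...   | _ , there (there 0∈) , refl with ∈-applyUpTo⁻ (λ i → suc (q + p + i)) 0∈
  ...     | _ , _ , ()
  hub-link (inj₂ (there b0∈)) | inj₂ b0∈′ | inj₂ b0∈″ with ∈-++⁻ chords b0∈″
  ... | inj₁ ∈chords with ∈-applyUpTo⁻ (λ i → suc i , q + suc i) ∈chords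
  ...   | _ , _ , ()
  hub-link (inj₂ (there b0∈)) | inj₂ b0∈′ | inj₂ b0∈″ | inj₂ ∈spare with ∈-replicate⁻ δ ∈spare
  ... | _ , ()

  hub-neighbours≤last : ∀ {a} → 1 ≤ r → a ∈ᴸ hub-neighbours → 1 ≤ a × a ≤ last
  hub-neighbours≤last 1≤r (here refl) = s≤s z≤n , ≤-trans (n≤1+n _) (≤-trans (m≤m+n q p) (m≤m+n (q + p) r))
  hub-neighbours≤last 1≤r (there (here refl)) = s≤s z≤n , ≤-trans (m≤m+n q p) (m≤m+n (q + p) r)
  hub-neighbours≤last 1≤r (there (there a∈)) with ∈-applyUpTo⁻ (λ i → suc (q + p + i)) a∈
  ... | i , i<r , refl = s≤s z≤n , +-monoʳ-< (q + p) i<r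

  hub-neighbours! : Unique hub-neighbours
  hub-neighbours! =
    (1+n≢n ∘ sym ∷ All.tabulate (λ a∈ → <⇒≢ (<-trans (n<1+n _) (late a∈)))) ∷
    (All.tabulate (λ a∈ → <⇒≢ (late a∈))) ∷
    Unique.applyUpTo⁺₁ (λ i → suc (q + p + i)) r (λ i<j _ → <⇒≢ (s≤s (+-monoʳ-< (q + p) i<j)))
    where
    late : ∀ {a} → a ∈ᴸ applyUpTo (λ i → suc (q + p + i)) r → q < a
    late a∈ with ∈-applyUpTo⁻ (λ i → suc (q + p + i)) a∈
    ... | i , _ , refl = s≤s (≤-trans (m≤m+n q p) (m≤m+n (q + p) i))

  graph : Graph n
  graph = fromEdges n L

  e-graph : e graph ≤ N + (2 + r) + p + δ
  e-graph = subst (e graph ≤_) length-L (e-fromEdges n L)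

  degree-hub : 1 ≤ r → degree graph zero ≡ 2 + r
  degree-hub 1≤r = subst (degree graph zero ≡_) length-hub-neighbours (≤-antisym
    (degree-fromEdges≤ n L {zero} hub-neighbours (λ _ _ → hub-link))
    (degree-fromEdges≥ n L {zero} hub-neighbours! λ a∈ → let 1≤a , a≤ = hub-neighbours≤last 1≤r a∈ in
      s≤s (≤-trans a≤ last≤N) , <⇒≢ 1≤a , inj₁ (spoke∈ a∈)))

  module _ (ds : List ℕ) where

    private
      _⟶*_ : ℕ → ℕ → Set
      _⟶*_ = Star (Step n L ds)

    Clear : ℕ → ℕ → Set
    Clear a b = ∀ {c} → a ≤ c → c ≤ b → c ∉ᴸ ds

    clear : ∀ {a b} → ¬ Any (Between a b) ds → Clear a b
    clear none a≤c c≤b c∈ = none (lose c∈ (a≤c , c≤b))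

    -- A walk does not test its start, so the zone to be clear begins at `suc a`; for the same
    -- reason it ends at `b` in `descend`, which starts from `suc b`.
    climb : ∀ {a b} → 1 ≤ a → a ≤ b → b ≤ N → Clear (suc a) b → a ⟶* b
    climb {a} {b} 1≤a a≤b b≤N ok with m≤n⇒m<n∨m≡n a≤b
    ... | inj₂ refl = ε
    climb {a} {suc b} 1≤a a≤b b<N ok | inj₁ a<b =
      climb 1≤a (s≤s⁻¹ a<b) (<⇒≤ b<N) (λ a<c c≤b → ok a<c (≤-trans c≤b (n≤1+n b)))
        ◅◅ (step (1+n≢n ∘ sym) (inj₁ (rim∈ (≤-trans 1≤a (s≤s⁻¹ a<b)) b<N)) (s≤s b<N) (ok a<b ≤-refl) ◅ ε)

    descend : ∀ {a b} → 1 ≤ a → a ≤ suc b → suc b ≤ N → Clear a b → suc b ⟶* a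
    descend {a} {b} 1≤a a≤b b<N ok with m≤n⇒m<n∨m≡n a≤b
    ... | inj₂ refl = ε
    descend {a} {zero}  1≤a a≤b b<N ok | inj₁ a<1 = contradiction 1≤a (<⇒≱ a<1)
    descend {a} {suc b} 1≤a a≤b b<N ok | inj₁ a<b =
      step 1+n≢n (inj₂ (rim∈ (s≤s z≤n) b<N)) (<-trans b<N (n<1+n N)) (ok (s≤s⁻¹ a<b) ≤-refl)
        ◅ descend 1≤a (s≤s⁻¹ a<b) (<⇒≤ b<N) (λ a≤c c≤b → ok a≤c (≤-trans c≤b (n≤1+n b)))

    to-hub : ∀ {a} → 0 ∉ᴸ ds → 1 ≤ a → a ∈ᴸ hub-neighbours → a ⟶* 0
    to-hub 0∉ 1≤a a∈ = step (>⇒≢ 1≤a) (inj₂ (spoke∈ a∈)) (s≤s z≤n) 0∉ ◅ ε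

    wrap : N ∉ᴸ ds → 1 ⟶* N
    wrap N∉ = step (<⇒≢ 2≤N) (inj₂ closing∈) (n<1+n N) N∉ ◅ ε

module Fans (p r δ N : ℕ) (N≡ : N ≡ 2 + p + p + r + δ) (2≤r : 2 ≤ r) (δ≤1 : δ ≤ 1) where

  open Ladder p r δ N N≡

  private
    p<q : suc p < q
    p<q = n<1+n (suc p)

    qp+1<last : suc (q + p) < last
    qp+1<last = ≤-trans (≤-reflexive (sym (+-comm (q + p) 2))) (+-monoʳ-≤ (q + p) 2≤r)

    q≤qp : q ≤ q + p
    q≤qp = m≤m+n q p

    q<last : q < last
    q<last = <-trans (s≤s q≤qp) qp+1<last

    qp+1≤N : suc (q + p) ≤ N
    qp+1≤N = ≤-trans (<⇒≤ qp+1<last) last≤N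

    q≤N : q ≤ N
    q≤N = ≤-trans (<⇒≤ q<last) last≤N

    1≤last : 1 ≤ last
    1≤last = ≤-trans (s≤s z≤n) (<⇒≤ q<last)

    apart : ∀ {a b c d x} → b < c → Between a b x → ¬ Between c d x
    apart b<c (_ , x≤b) (c≤x , _) = <-irrefl refl (≤-trans (s≤s x≤b) (≤-trans b<c c≤x))

    apart′ : ∀ {a b c d x} → b < c → Between c d x → ¬ Between a b x
    apart′ b<c cd ab = apart b<c ab cd

  module _ (x y : ℕ) (0∉ : 0 ∉ᴸ x ∷ y ∷ []) where

    private
      ds : List ℕ
      ds = x ∷ y ∷ []
      _⟶*_ : ℕ → ℕ → Set
      _⟶*_ = Star (Step n L ds)

      via-climb : ∀ {a b} → 1 ≤ a → a ≤ b → b ≤ N → b ∈ᴸ hub-neighbours →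
                  Clear ds (suc a) b → a ⟶* 0
      via-climb 1≤a a≤b b≤N b∈ ok = climb ds 1≤a a≤b b≤N ok ◅◅ to-hub ds 0∉ (≤-trans 1≤a a≤b) b∈

      via-descend : ∀ {a b} → 1 ≤ a → a ≤ suc b → suc b ≤ N → a ∈ᴸ hub-neighbours →
                    Clear ds a b → suc b ⟶* 0
      via-descend 1≤a a≤b b<N a∈ ok = descend ds 1≤a a≤b b<N ok ◅◅ to-hub ds 0∉ 1≤a a∈

      end→hub : Clear ds last N → N ⟶* 0
      end→hub ok = go N last≤N ≤-refl ok
        where
        go : ∀ b → last ≤ b → b ≤ N → Clear ds last b → b ⟶* 0
        go zero    last≤0 _ _  = contradiction (≤-trans 1≤last last≤0) λ ()
        go (suc b) last≤b b<N ok = via-descend 1≤last last≤b b<N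
          (late-spoke (<-trans (n<1+n _) qp+1<last) ≤-refl) (λ a≤c c≤b → ok a≤c (≤-trans c≤b (n≤1+n b)))

    -- Each of the next three lemmas gives three paths from a vertex to the hub
    -- whose interiors are disjoint, so that x and y cannot meet all of them.
    upper-rail : ∀ {i} → i < p → (q + suc i) ⟶* 0
    upper-rail {i} i<p = clear-zone
      -- The routes go down the rail to the spoke at `q`, up the rail to the spoke at `suc (q + p)`,
      -- and over the rung and up to the spoke at `suc p`.
      (between? q (q + i)) (between? (suc (q + suc i)) (suc (q + p))) (between? (suc i) (suc p))
      (apart (s≤s (+-monoʳ-≤ q (n≤1+n i)))) (apart′ p<q) (apart′ (≤-trans p<q (≤-trans (m≤m+n q (suc i)) (n≤1+n _))))
      (λ none → subst (_⟶* 0) (sym (+-suc q i)) (via-descend (s≤s z≤n) (≤-trans (m≤m+n q i) (n≤1+n _))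
        (≤-trans (≤-reflexive (sym (+-suc q i))) (≤-trans a≤ qp+1≤N)) (there (here refl)) (clear ds none)))
      (λ none → via-climb (s≤s z≤n) a≤ qp+1≤N (late-spoke (n<1+n _) (<⇒≤ qp+1<last)) (clear ds none))
      (λ none → let ok = clear ds none in
        step (>⇒≢ (m<n+m (suc i) {q} (s≤s z≤n))) (inj₂ (chord∈ i<p))
             (s≤s (≤-trans i<p (≤-trans (m≤n+m p 2) q≤N))) (ok ≤-refl (≤-trans i<p (n≤1+n p)))
          ◅ via-climb (s≤s z≤n) (≤-trans i<p (n≤1+n p)) (≤-trans (<⇒≤ p<q) q≤N) (here refl)
              (λ i<c → ok (<⇒≤ i<c)))
      where
      a≤ : q + suc i ≤ suc (q + p)
      a≤ = ≤-trans (+-monoʳ-≤ q i<p) (n≤1+n _)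

    lower-rail : ∀ {i} → i < p → suc i ⟶* 0
    lower-rail {i} i<p = clear-zone
      -- The routes go up to `suc p`, over the rung and up to `suc (q + p)`, and down to 1, through
      -- the closing edge to `N` and down to `last`; the third zone therefore has two pieces. It
      -- misses the second because `2 ≤ r` puts `last` beyond `suc (q + p)`.
      (between? (suc (suc i)) (suc p)) (between? (q + suc i) (suc (q + p)))
      (λ c → between? 1 i c ⊎-dec between? last N c)
      (apart (≤-trans p<q (m≤m+n q (suc i))))
      (λ up → [ apart′ (s≤s (n≤1+n i)) up , apart (<-trans p<q q<last) up ]′)
      (λ rung → [ apart′ (m≤n+m (suc i) q) rung , apart qp+1<last rung ]′)
      (λ none → via-climb (s≤s z≤n) (≤-trans i<p (n≤1+n p)) (≤-trans (<⇒≤ p<q) q≤N) (here refl) (clear ds none))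
      (λ none → let ok = clear ds none in
        step (<⇒≢ (m<n+m (suc i) {q} (s≤s z≤n))) (inj₁ (chord∈ i<p)) (s≤s (≤-trans a≤ qp+1≤N)) (ok ≤-refl a≤)
          ◅ via-climb (s≤s z≤n) a≤ qp+1≤N (late-spoke (n<1+n _) (<⇒≤ qp+1<last)) (λ a<c → ok (<⇒≤ a<c)))
      (λ none → let ok₁ = clear ds (none ∘ Any.map inj₁) ; ok₂ = clear ds (none ∘ Any.map inj₂) in
        descend ds ≤-refl (s≤s z≤n) (≤-trans i<p (≤-trans (m≤n+m p 2) q≤N)) ok₁
          ◅◅ wrap ds (ok₂ last≤N ≤-refl) ◅◅ end→hub ok₂)
      where
      a≤ : q + suc i ≤ suc (q + p)
      a≤ = ≤-trans (+-monoʳ-≤ q i<p) (n≤1+n _)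

    spare-vertex : 1 ≤ δ → N ⟶* 0
    spare-vertex 1≤δ = clear-zone
      -- One route for each neighbour of `N`: `last` and `q` have spokes, and from 1 the lower rail
      -- leads up to the spoke at `suc p`.
      (between? last last) (between? q q) (between? 1 (suc p))
      (apart′ q<last) (apart′ (<-trans p<q q<last)) (apart′ p<q)
      (λ none → subst (_⟶* 0) (sym N≡suc) (via-descend 1≤last (n≤1+n last) (≤-reflexive (sym N≡suc))
        (late-spoke (<-trans (n<1+n _) qp+1<last) ≤-refl) (clear ds none)))
      (λ none → let ok = clear ds none in
        step (>⇒≢ (<-≤-trans q<last last≤N)) (inj₁ (spare∈ 1≤δ)) (s≤s q≤N) (ok ≤-refl ≤-refl)
          ◅ to-hub ds 0∉ (s≤s z≤n) (there (here refl)))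
      (λ none → let ok = clear ds none in
        step (>⇒≢ (≤-trans (s≤s (s≤s z≤n)) q≤N)) (inj₁ closing∈) (s≤s (≤-trans 1≤last last≤N)) (ok ≤-refl (s≤s z≤n))
          ◅ via-climb ≤-refl (s≤s z≤n) (≤-trans (<⇒≤ p<q) q≤N) (here refl) (λ 1<c → ok (<⇒≤ 1<c)))
      where
      N≡suc : N ≡ suc last
      N≡suc = trans N≡ (trans (cong (last +_) (≤-antisym δ≤1 1≤δ)) (+-comm last 1))

    everywhere : ∀ {a} → a ≤ N → a ⟶* 0
    everywhere {zero}  _ = ε
    everywhere {suc i} a≤N with i <? p
    ... | yes i<p = lower-rail i<p
    ... | no  i≮p with suc i ≤? q
    ...   | yes a≤q = to-hub ds 0∉ (s≤s z≤n) (middle (≮⇒≥ i≮p) a≤q)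
      where
      middle : ∀ {i} → p ≤ i → suc i ≤ q → suc i ∈ᴸ hub-neighbours
      middle p≤i a≤q with m≤n⇒m<n∨m≡n p≤i
      ... | inj₁ p<i  = there (here (≤-antisym a≤q (s≤s p<i)))
      ... | inj₂ refl = here refl
    ...   | no  a≰q with suc i ≤? q + p
    ...     | yes a≤qp = subst (_⟶* 0) a≡ (upper-rail (+-cancelˡ-≤ q _ _ (≤-trans (≤-reflexive a≡) a≤qp)))
      where
      a≡ : q + suc (i ∸ q) ≡ suc i
      a≡ = trans (+-suc q _) (cong suc (m+[n∸m]≡n (s≤s⁻¹ (≰⇒> a≰q))))
    ...     | no  a≰qp with suc i ≤? last
    ...       | yes a≤last = to-hub ds 0∉ (s≤s z≤n) (late-spoke (≰⇒> a≰qp) a≤last)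
    -- Only the spare vertex `N` lies beyond `last`, and only for `δ ≡ 1`.
    ...       | no  a≰last = subst (_⟶* 0) (≤-antisym N≤ a≤N) (spare-vertex 1≤δ)
      where
      1≤δ : 1 ≤ δ
      1≤δ = +-cancelˡ-≤ last 1 δ (≤-trans (≤-reflexive (+-comm last 1)) (≤-trans (≰⇒> a≰last) (≤-trans a≤N (≤-reflexive N≡))))
      N≤ : N ≤ suc i
      N≤ = ≤-trans (≤-trans (≤-reflexive N≡) (+-monoʳ-≤ last δ≤1)) (≤-trans (≤-reflexive (+-comm last 1)) (≰⇒> a≰last))

  module _ (ds : List ℕ) (d : ℕ) (1≤d : 1 ≤ d) (d≤N : d ≤ N) (ds⊆ : ∀ {c} → c ∈ᴸ ds → c ≡ 0 ⊎ c ≡ d) where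

    private
      alive : ∀ {c} → 1 ≤ c → c ≢ d → c ∉ᴸ ds
      alive 1≤c c≢d c∈ with ds⊆ c∈
      ... | inj₁ refl = contradiction 1≤c λ ()
      ... | inj₂ c≡d  = c≢d c≡d

      below : ∀ {a} → a < d → Clear ds 1 a
      below a<d 1≤c c≤a = alive 1≤c (<⇒≢ (≤-<-trans c≤a a<d))

    -- Without the hub, the rim minus `d` is a path. Vertices above `d` climb to `N`, those below
    -- descend to 1 and take the closing edge to `N`; if `d` is `N` itself, 1 serves as root.
    rim-root : ∃[ c ] (c ≤ N × (∀ {a} → 1 ≤ a → a ≤ N → a ≢ d → Star (Step n L ds) a c))
    rim-root with d ≟ N
    ... | yes d≡N = 1 , ≤-trans 1≤d d≤N , to-1
      where
      to-1 : ∀ {a} → 1 ≤ a → a ≤ N → a ≢ d → Star (Step n L ds) a 1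
      to-1 {suc a} _ a≤N _ = descend ds ≤-refl (s≤s z≤n) a≤N (below (≤-trans a≤N (≤-reflexive (sym d≡N))))
    ... | no d≢N = N , ≤-refl , to-N
      where
      to-N : ∀ {a} → 1 ≤ a → a ≤ N → a ≢ d → Star (Step n L ds) a N
      to-N {suc a} 1≤a a≤N a≢d with <-cmp (suc a) d
      ... | tri< a<d _ _ = descend ds ≤-refl (s≤s z≤n) a≤N (below (<-trans (n<1+n a) a<d))
        ◅◅ wrap ds (alive (≤-trans 1≤a a≤N) (d≢N ∘ sym))
      ... | tri≈ _ a≡d _ = contradiction a≡d a≢d
      ... | tri> _ _ d<a = climb ds 1≤a a≤N ≤-refl
        λ a<c _ → alive (≤-trans (s≤s z≤n) a<c) (>⇒≢ (<-trans d<a a<c))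

module _ (p r δ N : ℕ) (N≡ : N ≡ 2 + p + p + r + δ) (2≤r : 2 ≤ r) (δ≤1 : δ ≤ 1) where

  open Ladder p r δ N N≡
  open Fans p r δ N N≡ 2≤r δ≤1

  ladder-conn : ∀ {x y : Fin n} → x ≢ y → Conn graph (allBut (x ∷ y ∷ []))
  ladder-conn {x} {y} x≢y = by-hub x y x≢y
    where
    -- The list `xs` is general in order to cover both orders of the hub and `z`.
    without-hub : ∀ (xs : List (Fin n)) (z : Fin n) → z ≢ zero → zero ∈ᴸ xs → z ∈ᴸ xs →
                  (∀ {c} → c ∈ᴸ map toℕ xs → c ≡ 0 ⊎ c ≡ toℕ z) → Conn graph (allBut xs)
    without-hub xs z z≢0 0∈ z∈ xs⊆ =
      let 1≤z = n≢0⇒n>0 (z≢0 ∘ Fin.toℕ-injective)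
          c , c≤N , to-c = rim-root (map toℕ xs) (toℕ z) 1≤z (s≤s⁻¹ (Fin.toℕ<n z)) xs⊆
      in conn-from {G = graph} (Fin.fromℕ< (s≤s c≤N)) λ {u} u∈ →
        steps⇒inside n L {xs} refl (Fin.toℕ-fromℕ< (s≤s c≤N)) u∈
          (to-c (n≢0⇒n>0 (λ u≡0 → ∈-allBut⁻ xs u∈ (subst (_∈ᴸ xs) (sym (Fin.toℕ-injective u≡0)) 0∈)))
                (s≤s⁻¹ (Fin.toℕ<n u))
                (λ u≡z → ∈-allBut⁻ xs u∈ (subst (_∈ᴸ xs) (sym (Fin.toℕ-injective u≡z)) z∈)))
    by-hub : ∀ x y → x ≢ y → Conn graph (allBut (x ∷ y ∷ []))
    by-hub zero    zero    x≢y = contradiction refl x≢y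
    by-hub zero    (suc y) _   = without-hub (zero ∷ suc y ∷ []) (suc y) (λ ()) (here refl) (there (here refl))
      λ { (here eq) → inj₁ eq ; (there (here eq)) → inj₂ eq }
    by-hub (suc x) zero    _   = without-hub (suc x ∷ zero ∷ []) (suc x) (λ ()) (there (here refl)) (here refl)
      λ { (here eq) → inj₂ eq ; (there (here eq)) → inj₁ eq }
    by-hub (suc x) (suc y) _   = conn-from {G = graph} zero λ {u} u∈ →
      steps⇒inside n L {suc x ∷ suc y ∷ []} refl refl u∈
        (everywhere (suc (toℕ x)) (suc (toℕ y)) (λ { (here ()) ; (there (here ())) ; (there (there ())) })
          (s≤s⁻¹ (Fin.toℕ<n u)))

  private
    4≤N : 4 ≤ N
    4≤N = ≤-trans (+-mono-≤ (s≤s (s≤s (z≤n {p + p}))) 2≤r) last≤N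

    5≤n : 5 ≤ n
    5≤n = s≤s 4≤N

    2≤n : 2 ≤ n
    2≤n = ≤-trans (s≤s (s≤s z≤n)) 5≤n

    m : ℕ
    m = N + (2 + r) + p + δ

    -- Twice the size exceeds the least conceivable degree sum, 3 on each of the `N` rim vertices
    -- and `2 + r` at the hub, by exactly `δ`.
    m+m : m + m ≡ N * 3 + (2 + r) + δ
    m+m = subst (λ N → N + (2 + r) + p + δ + (N + (2 + r) + p + δ) ≡ N * 3 + (2 + r) + δ) (sym N≡) (count p r δ)
      where
      count : ∀ p r δ → let N = 2 + p + p + r + δ in
              N + (2 + r) + p + δ + (N + (2 + r) + p + δ) ≡ N * 3 + (2 + r) + δ
      count = solve-∀

  ladder-sdiam : sdiam (n ∸ 2) graph ≤⁺ [ n ∸ 3 ]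
  ladder-sdiam = sdiam≤⁺ {G = graph} λ S ∣S∣ →
    let ∣els∣ = trans (length-elements S) ∣S∣
        x , x∉ = ∉-fresh (elements S) (≤-trans (s≤s (≤-reflexive ∣els∣)) (<⇒≤ n-2<))
        y , y∉ = ∉-fresh (x ∷ elements S) (≤-trans (s≤s (s≤s (≤-reflexive ∣els∣))) n-2<)
        x≢y = λ x≡y → y∉ (here (sym x≡y))
        c , c∉ = ∉-fresh (x ∷ y ∷ []) (≤-trans (s≤s (s≤s (s≤s z≤n))) 5≤n)
    in allBut (x ∷ y ∷ []) ,
       (λ v∈ → ∈-allBut⁺ (x ∷ y ∷ []) (∉pair (λ { refl → x∉ (∈-elements⁺ v∈) })
                                             (λ { refl → y∉ (there (∈-elements⁺ v∈)) }))) ,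
       ladder-conn x≢y ,
       (c , ∈-allBut⁺ (x ∷ y ∷ []) c∉) ,
       ≤-reflexive (trans (∣allBut-pair∣ x≢y) (+-∸-assoc 1 {n} {3} (≤-trans (s≤s (s≤s (s≤s z≤n))) 5≤n)))
    where
    n-2< : 2 + (n ∸ 2) ≤ n
    n-2< = ≤-reflexive (m+[n∸m]≡n 2≤n)

  -- The rim vertices have degree at least 3 and the sum of all degrees is at
  -- most 2m, which leaves at most 3 + δ for a single rim vertex.
  ladder-degree≤ : ∀ v → degree graph v ≤ 2 + r
  ladder-degree≤ zero = ≤-reflexive (degree-hub (<⇒≤ 2≤r))
  ladder-degree≤ v@(suc _) = ≤-trans (+-cancelˡ-≤ (2 + r + n * 3) _ _ bound)
    -- `3 + δ ≤ 4 ≤ 2 + r`, so ℓ ≥ 4 also ensures that no rim vertex exceeds the hub.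
    (≤-trans (+-monoʳ-≤ 3 δ≤1) (+-monoʳ-≤ 2 2≤r))
    where
    open ≤-Reasoning
    bound : 2 + r + n * 3 + degree graph v ≤ 2 + r + n * 3 + (3 + δ)
    bound = begin
      2 + r + n * 3 + degree graph v
        ≡⟨ cong (λ d → d + n * 3 + degree graph v) (degree-hub (<⇒≤ 2≤r)) ⟨
      degree graph zero + n * 3 + degree graph v
        ≡⟨ swap-last (degree graph zero) (degree graph v) n ⟩
      degree graph zero + (degree graph v + 0) + n * 3
        ≤⟨ degree-sum {G = graph} 5≤n ladder-sdiam (pair! {x = zero} {v} λ ()) ⟩
      e graph + e graph + 6
        ≤⟨ +-monoˡ-≤ 6 (+-mono-≤ e-graph e-graph) ⟩
      m + m + 6
        ≡⟨ cong (_+ 6) m+m ⟩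
      N * 3 + (2 + r) + δ + 6
        ≡⟨ total N r δ ⟩
      2 + r + n * 3 + (3 + δ)
        ∎
      where
      swap-last : ∀ a b n → a + n * 3 + b ≡ a + (b + 0) + n * 3
      swap-last = solve-∀
      total : ∀ N r δ → N * 3 + (2 + r) + δ + 6 ≡ 2 + r + suc N * 3 + (3 + δ)
      total = solve-∀

  -- One edge less lowers twice the size by 2, but `m + m` is only `δ ≤ 1` above the bound given by
  -- the degrees.
  ladder-minimum : ∀ (H : Graph n) → ℋ (n ∸ 2) n (2 + r) (n ∸ 3) H → m ≤ e H
  ladder-minimum H (Δ≡ , diam≤) = let v , deg≡ = Δ≡⁻ {G = H} (s≤s z≤n) Δ≡ in
    ≮⇒≥ λ e<m → <⇒≱ (≤-<-trans δ≤1 (n<1+n 1)) (+-cancelˡ-≤ (n * 3 + (2 + r)) 2 δ (bound v deg≡ e<m))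
    where
    open ≤-Reasoning
    bound : ∀ v → degree H v ≡ 2 + r → e H < m → n * 3 + (2 + r) + 2 ≤ n * 3 + (2 + r) + δ
    bound v deg≡ e<m = begin
      n * 3 + (2 + r) + 2
        ≡⟨ cong (λ d → n * 3 + d + 2) deg≡ ⟨
      n * 3 + degree H v + 2
        ≡⟨ cong (_+ 2) (trans (+-comm (n * 3) _) (cong (_+ n * 3) (sym (+-identityʳ _)))) ⟩
      degree H v + 0 + n * 3 + 2
        ≤⟨ +-monoˡ-≤ 2 (degree-sum {G = H} 5≤n diam≤ ([] ∷ [])) ⟩
      e H + e H + 3 + 2
        ≡⟨ regroup (e H) ⟩
      suc (e H) + suc (e H) + 3
        ≤⟨ +-monoˡ-≤ 3 (+-mono-≤ e<m e<m) ⟩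
      m + m + 3
        ≡⟨ cong (_+ 3) m+m ⟩
      N * 3 + (2 + r) + δ + 3
        ≡⟨ total N r δ ⟩
      n * 3 + (2 + r) + δ
        ∎
      where
      regroup : ∀ e → e + e + 3 + 2 ≡ suc e + suc e + 3
      regroup = solve-∀
      total : ∀ N r δ → N * 3 + (2 + r) + δ + 3 ≡ suc N * 3 + (2 + r) + δ
      total = solve-∀

  eMin-ladder : eMin (n ∸ 2) n (2 + r) (n ∸ 3) ≡ [ m ]
  eMin-ladder = eMin≡ {n} {n ∸ 2} {2 + r} {n ∸ 3} {m} graph
    (Δ≡⁺ {ℓ = 2 + r} {G = graph} zero (degree-hub (<⇒≤ 2≤r)) ladder-degree≤ , ladder-sdiam)
    e-graph ladder-minimum

-- Closed formulas and bounds for the diameter bound n ∸ 3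

eMin[n∸3] : ∀ n ℓ p δ → 4 ≤ ℓ → δ ≤ 1 → n ≡ suc (ℓ + (p + p) + δ) →
            eMin (n ∸ 2) n ℓ (n ∸ 3) ≡ [ n ∸ 1 + ℓ + p + δ ]
eMin[n∸3] (suc N) (suc (suc r)) p δ 4≤ℓ δ≤1 n≡ = eMin-ladder p r δ N
  (trans (suc-injective n≡) (reorder p r δ)) (s≤s⁻¹ (s≤s⁻¹ 4≤ℓ)) δ≤1
  where
  reorder : ∀ p r δ → 2 + r + (p + p) + δ ≡ 2 + p + p + r + δ
  reorder = solve-∀
eMin[n∸3] (suc N) (suc zero) p δ (s≤s ()) δ≤1 n≡

-- The four formulas are the cases p = 0, 1, 2, 3 with `i` as the parity `δ`. The hypothesis on `n`
-- says that ℓ ≥ 4.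
eMin[n∸3]-large : ∀ p i n → i ≤ 1 → 5 + (p + p) + i ≤ n →
                  eMin (n ∸ 2) n (n ∸ suc (p + p) ∸ i) (n ∸ 3) ≡ [ 2 * n ∸ (2 + p) ]
eMin[n∸3]-large p i n i≤1 n≥ = trans (eMin[n∸3] n ℓ p i 4≤ℓ i≤1 n≡) (cong [_] size)
  where
  ℓ : ℕ
  ℓ = n ∸ suc (p + p) ∸ i
  ℓ≡ : ℓ ≡ n ∸ suc (p + p + i)
  ℓ≡ = ∸-+-assoc n (suc (p + p)) i
  4≤ℓ : 4 ≤ ℓ
  4≤ℓ = ≤-trans (≤-trans (≤-reflexive (sym (m+n∸n≡m 4 (suc (p + p + i)))))
    (∸-monoˡ-≤ (suc (p + p + i)) (≤-trans (≤-reflexive (shift-suc p i)) n≥))) (≤-reflexive (sym ℓ≡))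
    where
    shift-suc : ∀ p i → 4 + suc (p + p + i) ≡ 5 + (p + p) + i
    shift-suc = solve-∀
  n≡ : n ≡ suc (ℓ + (p + p) + i)
  n≡ = begin
    n                                              ≡⟨ m∸n+n≡m (≤-trans (m≤n+m _ 4) n≥) ⟨
    n ∸ suc (p + p + i) + suc (p + p + i)          ≡⟨ cong (_+ suc (p + p + i)) ℓ≡ ⟨
    ℓ + suc (p + p + i)                            ≡⟨ trans (+-suc ℓ _) (cong suc (sym (+-assoc ℓ (p + p) i))) ⟩
    suc (ℓ + (p + p) + i)                          ∎
    where open ≡-Reasoning
  size : n ∸ 1 + ℓ + p + i ≡ 2 * n ∸ (2 + p)
  size = begin
    n ∸ 1 + ℓ + p + i
      ≡⟨ cong (λ n → n ∸ 1 + ℓ + p + i) n≡ ⟩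
    ℓ + (p + p) + i + ℓ + p + i
      ≡⟨ m+n∸n≡m _ (2 + p) ⟨
    ℓ + (p + p) + i + ℓ + p + i + (2 + p) ∸ (2 + p)
      ≡⟨ cong (_∸ (2 + p)) (double ℓ p i) ⟩
    2 * suc (ℓ + (p + p) + i) ∸ (2 + p)
      ≡⟨ cong (λ n → 2 * n ∸ (2 + p)) n≡ ⟨
    2 * n ∸ (2 + p)
      ∎
    where
    open ≡-Reasoning
    double : ∀ ℓ p i → ℓ + (p + p) + i + ℓ + p + i + (2 + p) ≡ 2 * suc (ℓ + (p + p) + i)
    double = solve-∀

-- The least values r = 1 and s = 2 give n = 9 + ℓ. Shifting by them turns the equation into
-- division of `n ∸ 9 ∸ ℓ` by 4, with quotient r ∸ 1 and remainder s ∸ 2.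
residue : ∀ n ℓ → 6 ≤ ℓ → ℓ ≤ n ∸ 9 →
          ∃! _≡_ (λ s → 2 ≤ s × s ≤ 5 × ∃[ r ] (1 ≤ r × n ≡ 4 * r + ℓ + s + 3))
residue n ℓ 6≤ℓ ℓ≤ = 2 + t % 4 ,
  (s≤s (s≤s z≤n) , s≤s (s≤s (s≤s⁻¹ (m%n<n t 4))) , suc (t / 4) , s≤s z≤n , n≡) ,
  λ (2≤s , s≤5 , r , 1≤r , n≡′) → unique 2≤s s≤5 r 1≤r n≡′
  where
  t : ℕ
  t = n ∸ 9 ∸ ℓ
  9+ℓ+t≡n : 9 + (ℓ + t) ≡ n
  9+ℓ+t≡n = trans (cong (9 +_) (m+[n∸m]≡n ℓ≤))
    -- `6 ≤ ℓ ≤ n ∸ 9` makes the truncated difference positive, hence `9 < n`.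
    (m+[n∸m]≡n {9} (<⇒≤ (m∸n≢0⇒n<m {n} {9} (>⇒≢ (≤-trans (s≤s z≤n) (≤-trans 6≤ℓ ℓ≤))))))
  n≡ : n ≡ 4 * suc (t / 4) + ℓ + (2 + t % 4) + 3
  n≡ = trans (sym 9+ℓ+t≡n) (trans (cong (λ t → 9 + (ℓ + t)) (m≡m%n+[m/n]*n t 4)) (regroup ℓ (t % 4) (t / 4)))
    where
    regroup : ∀ ℓ c k → 9 + (ℓ + (c + k * 4)) ≡ 4 * suc k + ℓ + (2 + c) + 3
    regroup = solve-∀
  unique : ∀ {s} → 2 ≤ s → s ≤ 5 → ∀ r → 1 ≤ r → n ≡ 4 * r + ℓ + s + 3 → 2 + t % 4 ≡ s
  unique {suc (suc c)} _ (s≤s (s≤s c≤3)) (suc k) _ n≡′ = cong (2 +_) (begin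
    t % 4              ≡⟨ cong (_% 4) (+-cancelˡ-≡ (9 + ℓ) t (c + k * 4) (trans (trans 9+ℓ+t≡n n≡′) (regroup ℓ c k))) ⟩
    (c + k * 4) % 4    ≡⟨ [m+kn]%n≡m%n c k 4 ⟩
    c % 4              ≡⟨ m<n⇒m%n≡m (s≤s c≤3) ⟩
    c                  ∎)
    where
    open ≡-Reasoning
    regroup : ∀ ℓ c k → 4 * suc k + ℓ + (2 + c) + 3 ≡ 9 + ℓ + (c + k * 4)
    regroup = solve-∀
  unique {suc zero} (s≤s ()) _ _ _ _

-- All inequalities are doubled to avoid halves, and the witness `m` records that the minimum is
-- finite.
Bounds : (n ℓ s : ℕ) → Set
Bounds n ℓ s = ∃[ m ] (eMin (n ∸ 2) n ℓ (n ∸ 3) ≡ [ m ]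
  × 3 * n + ℓ ∸ 3 ≤ 2 * m
  × 2 * m ≤ 3 * n + ℓ + s ∸ 5
  × (s ≡ 2 → 2 * m ≡ 3 * n + ℓ ∸ 3))

-- With s = 2 + s′ the number of rim vertices without a spoke is 4r + s′ + 4, so `p = 2 * r + u`
-- where `u` and `δ` come from halving s′ + 4. The exact value satisfies 2m = 3n + ℓ ∸ 3 + δ, while
-- the two bounds put 0 and s′ in place of `δ`; they coincide for s = 2.
bounds : ∀ n ℓ s′ u δ r → 6 ≤ ℓ → δ ≤ 1 → δ ≤ s′ → s′ + 4 ≡ 2 * u + δ →
         n ≡ 4 * r + ℓ + (2 + s′) + 3 → Bounds n ℓ (2 + s′)
bounds n ℓ s′ u δ r 6≤ℓ δ≤1 δ≤s′ s′+4≡ n≡ =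
  m , eMin[n∸3] n ℓ p δ (≤-trans (m≤n+m 4 2) 6≤ℓ) δ≤1 n≡M , lower , upper , exact
  where
  open ≤-Reasoning
  p M m : ℕ
  p = 2 * r + u
  M = ℓ + (p + p) + δ
  m = n ∸ 1 + ℓ + p + δ
  n≡M : n ≡ suc M
  n≡M = begin-equality
    n                                  ≡⟨ trans n≡ (regroup₁ r ℓ s′) ⟩
    suc (4 * r + ℓ + (s′ + 4))         ≡⟨ cong (λ x → suc (4 * r + ℓ + x)) s′+4≡ ⟩
    suc (4 * r + ℓ + (2 * u + δ))      ≡⟨ cong suc (regroup₂ r ℓ u δ) ⟩
    suc M                              ∎
    where
    regroup₁ : ∀ r ℓ s → 4 * r + ℓ + (2 + s) + 3 ≡ suc (4 * r + ℓ + (s + 4))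
    regroup₁ = solve-∀
    regroup₂ : ∀ r ℓ u δ → 4 * r + ℓ + (2 * u + δ) ≡ ℓ + (2 * r + u + (2 * r + u)) + δ
    regroup₂ = solve-∀
  2m : 2 * m ≡ 3 * M + ℓ + δ
  2m = trans (cong (λ n → 2 * (n ∸ 1 + ℓ + p + δ)) n≡M) (count ℓ p δ)
    where
    count : ∀ ℓ p δ → 2 * (ℓ + (p + p) + δ + ℓ + p + δ) ≡ 3 * (ℓ + (p + p) + δ) + ℓ + δ
    count = solve-∀
  3n : 3 * n + ℓ ∸ 3 ≡ 3 * M + ℓ
  3n = trans (cong (λ n → 3 * n + ℓ ∸ 3) n≡M) (trans (cong (_∸ 3) (count M ℓ)) (m+n∸n≡m (3 * M + ℓ) 3))
    where
    count : ∀ M ℓ → 3 * suc M + ℓ ≡ 3 * M + ℓ + 3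
    count = solve-∀
  lower : 3 * n + ℓ ∸ 3 ≤ 2 * m
  lower = subst₂ _≤_ (sym 3n) (sym 2m) (m≤m+n (3 * M + ℓ) δ)
  upper : 2 * m ≤ 3 * n + ℓ + (2 + s′) ∸ 5
  upper = begin
    2 * m                          ≡⟨ 2m ⟩
    3 * M + ℓ + δ                  ≤⟨ +-monoʳ-≤ (3 * M + ℓ) δ≤s′ ⟩
    3 * M + ℓ + s′                 ≡⟨ m+n∸n≡m (3 * M + ℓ + s′) 5 ⟨
    3 * M + ℓ + s′ + 5 ∸ 5         ≡⟨ cong (_∸ 5) (count M ℓ s′) ⟩
    3 * suc M + ℓ + (2 + s′) ∸ 5   ≡⟨ cong (λ n → 3 * n + ℓ + (2 + s′) ∸ 5) n≡M ⟨
    3 * n + ℓ + (2 + s′) ∸ 5       ∎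
    where
    count : ∀ M ℓ s → 3 * M + ℓ + s + 5 ≡ 3 * suc M + ℓ + (2 + s)
    count = solve-∀
  exact : 2 + s′ ≡ 2 → 2 * m ≡ 3 * n + ℓ ∸ 3
  exact s≡2 = begin-equality
    2 * m              ≡⟨ 2m ⟩
    3 * M + ℓ + δ      ≡⟨ cong (3 * M + ℓ +_) (n≤0⇒n≡0 (≤-trans δ≤s′ (≤-reflexive (+-cancelˡ-≡ 2 s′ 0 s≡2)))) ⟩
    3 * M + ℓ + 0      ≡⟨ +-identityʳ _ ⟩
    3 * M + ℓ          ≡⟨ 3n ⟨
    3 * n + ℓ ∸ 3      ∎

all-bounds : ∀ n ℓ → 6 ≤ ℓ → ∀ s r → 2 ≤ s → s ≤ 5 → n ≡ 4 * r + ℓ + s + 3 → Bounds n ℓ s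
all-bounds n ℓ 6≤ℓ 2 r _ _ n≡ = bounds n ℓ 0 2 0 r 6≤ℓ z≤n z≤n refl n≡
all-bounds n ℓ 6≤ℓ 3 r _ _ n≡ = bounds n ℓ 1 2 1 r 6≤ℓ ≤-refl ≤-refl refl n≡
all-bounds n ℓ 6≤ℓ 4 r _ _ n≡ = bounds n ℓ 2 3 0 r 6≤ℓ z≤n z≤n refl n≡
all-bounds n ℓ 6≤ℓ 5 r _ _ n≡ = bounds n ℓ 3 3 1 r 6≤ℓ ≤-refl (s≤s z≤n) refl n≡
all-bounds n ℓ 6≤ℓ 1 r (s≤s ()) _ n≡
all-bounds n ℓ 6≤ℓ (suc (suc (suc (suc (suc (suc s)))))) r _ (s≤s (s≤s (s≤s (s≤s (s≤s ()))))) n≡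

theorem3p1 : ∀ n → 5 ≤ n →
    (∀ ℓ → 2 ≤ ℓ → ℓ ≤ n ∸ 1 → eMin (n ∸ 2) n ℓ (n ∸ 1) ≡ [ n ∸ 1 ])
    ×
    (∀ ℓ → 2 ≤ ℓ → ℓ ≤ n ∸ 1 →
    (ℓ ≤ n ∸ 2 → eMin (n ∸ 2) n ℓ (n ∸ 2) ≡ [ n ]) ×
    (ℓ ≡ n ∸ 1 → eMin (n ∸ 2) n ℓ (n ∸ 2) ≡ [ n ∸ 1 ]))
    ×
    (∀ i → i ≤ 1 →
    (5 + i ≤ n → eMin (n ∸ 2) n (n ∸ 1 ∸ i) (n ∸ 3) ≡ [ 2 * n ∸ 2 ]) ×
    (7 + 2 * i ≤ n → eMin (n ∸ 2) n (n ∸ 3 ∸ i) (n ∸ 3) ≡ [ 2 * n ∸ 3 ]) ×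
    (11 + 2 * i ≤ n → eMin (n ∸ 2) n (n ∸ 5 ∸ i) (n ∸ 3) ≡ [ 2 * n ∸ 4 ]) ×
    (15 + 2 * i ≤ n → eMin (n ∸ 2) n (n ∸ 7 ∸ i) (n ∸ 3) ≡ [ 2 * n ∸ 5 ]))
    ×
    (∀ ℓ → 6 ≤ ℓ → ℓ ≤ n ∸ 9 →
    ∃! _≡_ (λ s → 2 ≤ s × s ≤ 5 × ∃[ r ] (1 ≤ r × n ≡ 4 * r + ℓ + s + 3))
    ×
    (∀ s r → 2 ≤ s → s ≤ 5 → 1 ≤ r → n ≡ 4 * r + ℓ + s + 3 →
    ∃[ m ] (eMin (n ∸ 2) n ℓ (n ∸ 3) ≡ [ m ]
    × 3 * n + ℓ ∸ 3 ≤ 2 * m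
    × 2 * m ≤ 3 * n + ℓ + s ∸ 5
    × (s ≡ 2 → 2 * m ≡ 3 * n + ℓ ∸ 3))))
theorem3p1 n 5≤n =
  (λ ℓ → eMin[n∸1] n ℓ 5≤n) ,
  (λ ℓ 2≤ℓ _ → eMin[n∸2] n ℓ 5≤n 2≤ℓ , λ { refl → eMin[n∸2]-star n 5≤n }) ,
  (λ i i≤1 → eMin[n∸3]-large 0 i n i≤1
           , eMin[n∸3]-large 1 i n i≤1 ∘ ≤-trans (+-monoʳ-≤ 7 (m≤m+n i _))
           , eMin[n∸3]-large 2 i n i≤1 ∘ ≤-trans (+-mono-≤ (m≤m+n 9 2) (m≤m+n i _))
           , eMin[n∸3]-large 3 i n i≤1 ∘ ≤-trans (+-mono-≤ (m≤m+n 11 4) (m≤m+n i _))) ,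
  (λ ℓ 6≤ℓ ℓ≤ → residue n ℓ 6≤ℓ ℓ≤ , λ s r 2≤s s≤5 _ → all-bounds n ℓ 6≤ℓ s r 2≤s s≤5)
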